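{- Let $n\ge 1$ and $m\ge 2$ be integers and let $\{H_1,\dots,H_m\}$ be a set of mutually unbiased Bush-type Hadamard matrices of order $4n^2$. Let $N=4n^2(m+1)$ and let $M$ be the $N\times N$ matrix $$M=\begin{bmatrix} I_{4n^2}\\ \frac{1}{2n}H_1\\ \vdots\\ \frac{1}{2n}H_m\end{bmatrix}\begin{bmatrix} I_{4n^2} & \frac{1}{2n}H_1^t & \cdots & \frac{1}{2n}H_m^t\end{bmatrix}.$$ Then $B=2n(M-I_N)$ is a symmetric $(0,1,-1)$-matrix; write $B=B_1-B_2$ with $B_1,B_2$ disjoint $(0,1)$-matrices. Define $$A_0=I_N,\qquad A_1=I_{m+1}\otimes I_{2n}\otimes (J_{2n}-I_{2n}),\qquad A_2=I_{m+1}\otimes (J_{2n}-I_{2n})\otimes J_{2n},$$ $$A_3=(J_{m+1}-I_{m+1})\otimes I_{2n}\otimes J_{2n},\qquad A_4=B_1-A_3,\qquad A_5=B_2.$$ Then $A_0,A_1,A_2,A_3,A_4,A_5$ form a (symmetric) $5$-class association scheme.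
   Context: $I_k$ and $J_k$ denote the identity matrix and the all-ones matrix of order $k$; $\otimes$ is the Kronecker product. Two $(0,1)$-matrices are disjoint if no position is $1$ in both. A Hadamard matrix of order $k$ is a $k\times k$ matrix with entries in $\{ -1,1\}$ and pairwise orthogonal rows. Two Hadamard matrices $H,K$ of order $k$ are unbiased if $HK^t=\sqrt{k}\,L$ for some Hadamard matrix $L$; a set of Hadamard matrices is mutually unbiased if any two distinct members are unbiased. A Bush-type Hadamard matrix of order $4n^2$ is a Hadamard matrix $H=[H_{ij}]_{1\le i,j\le 2n}$ of order $4n^2$, partitioned into $2n\times 2n$ blocks $H_{ij}$, such that $H_{ii}=J_{2n}$ for all $i$ and $H_{ij}J_{2n}=J_{2n}H_{ij}=0$ for all $i\neq j$. A symmetric $d$-class association scheme on a vertex set of size $N$ is a set of nonzero symmetric $(0,1)$-matrices $A_0,\dots,A_d$ of order $N$ such that (1) $A_0=I_N$; (2) $\sum_{i=0}^d A_i=J_N$; (3) for all $i,j$, $A_iA_j=\sum_{k=0}^d p_{ij}^kA_k$ for some numbers $p_{ij}^k$. -}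

module Defs where

open import Algebra.Definitions.RawMonoid using (sum)
open import Data.Bool.Base using (if_then_else_)
open import Data.Fin.Base using (Fin; zero; combine; quotient; remainder)
open import Data.Fin.Properties using (_≟_)
open import Data.Integer.Base using (+_)
open import Data.Nat.Base as ℕ using (ℕ; suc; NonZero)
open import Data.Nat.Properties using (m*n≢0)
open import Data.Product.Base using (_×_; ∃-syntax; Σ-syntax)
open import Data.Rational.Base using (ℚ; 0ℚ; 1ℚ; _+_; _*_; _-_; -_; _/_; +-0-rawMonoid)
open import Data.Sum.Base using (_⊎_)
open import Data.Vec.Functional using (Vector; []; _∷_)
open import Relation.Binary.PropositionalEquality.Core using (_≡_; _≢_)
open import Relation.Nullary.Decidable.Core using (does)
open import Relation.Nullary.Negation.Core using (¬_)

infix  4 _≈_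
infixl 6 _⊖_
infixl 7 _⊛_
infixr 7 _•_
infixr 8 _⊗_
infix  9 _ᵗ

∑ : ∀ {k} → Vector ℚ k → ℚ
∑ = sum +-0-rawMonoid

Matrix : ℕ → ℕ → Set
Matrix r c = Fin r → Fin c → ℚ

SqMatrix : ℕ → Set
SqMatrix k = Matrix k k

_≈_ : ∀ {r c} → Matrix r c → Matrix r c → Set
A ≈ B = ∀ i j → A i j ≡ B i j

O : ∀ r c → Matrix r c
O r c i j = 0ℚ

I : ∀ k → SqMatrix k
I k i j = if does (i ≟ j) then 1ℚ else 0ℚ

J : ∀ k → SqMatrix k
J k i j = 1ℚ

_ᵗ : ∀ {r c} → Matrix r c → Matrix c r
(A ᵗ) i j = A j i

_⊖_ : ∀ {r c} → Matrix r c → Matrix r c → Matrix r c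
(A ⊖ B) i j = A i j - B i j

_•_ : ∀ {r c} → ℚ → Matrix r c → Matrix r c
(q • A) i j = q * A i j

_⊛_ : ∀ {r s c} → Matrix r s → Matrix s c → Matrix r c
(A ⊛ B) i j = ∑ λ l → A i l * B l j

∑ᴹ : ∀ {k r c} → Vector (Matrix r c) k → Matrix r c
∑ᴹ A i j = ∑ λ l → A l i j

-- Kronecker product: position (a , b) of a product index is encoded by
-- `combine a b`, so the left factor selects the block.
_⊗_ : ∀ {r c r′ c′} → Matrix r c → Matrix r′ c′ → Matrix (r ℕ.* r′) (c ℕ.* c′)
_⊗_ {r} {c} {r′} {c′} A B i j =
  A (quotient r′ i) (quotient c′ j) * B (remainder {r} r′ i) (remainder {c} c′ j)

block : ∀ {a b r c} → Matrix (a ℕ.* r) (b ℕ.* c) → Fin a → Fin b → Matrix r c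
block A i j x y = A (combine i x) (combine j y)

blockColumn : ∀ {b r c} → Vector (Matrix r c) b → Matrix (b ℕ.* r) c
blockColumn {b} {r} As i j = As (quotient r i) (remainder {b} r i) j

blockRow : ∀ {b r c} → Vector (Matrix r c) b → Matrix r (b ℕ.* c)
blockRow {b} {r} {c} As i j = As (quotient c j) i (remainder {b} c j)

IsSymmetric : ∀ {k} → SqMatrix k → Set
IsSymmetric A = A ᵗ ≈ A

IsZeroOne : ∀ {r c} → Matrix r c → Set
IsZeroOne A = ∀ i j → A i j ≡ 0ℚ ⊎ A i j ≡ 1ℚ

IsZeroOneMinusOne : ∀ {r c} → Matrix r c → Set
IsZeroOneMinusOne A = ∀ i j → A i j ≡ 0ℚ ⊎ A i j ≡ 1ℚ ⊎ A i j ≡ - 1ℚ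

Disjoint : ∀ {r c} → Matrix r c → Matrix r c → Set
Disjoint A B = ∀ i j → ¬ (A i j ≡ 1ℚ × B i j ≡ 1ℚ)

record IsHadamard {k} (H : SqMatrix k) : Set where
  field
    entries    : ∀ i j → H i j ≡ - 1ℚ ⊎ H i j ≡ 1ℚ
    orthogonal : ∀ i j → i ≢ j → ∑ (λ l → H i l * H j l) ≡ 0ℚ

-- H Kᵗ = √k L.  The entries of H Kᵗ are integers and those of L are ±1, so
-- √k is a natural number whenever k > 0 and such an L exists; s is that root.
Unbiased : ∀ {k} → SqMatrix k → SqMatrix k → Set
Unbiased {k} H K =
  ∃[ s ] s ℕ.* s ≡ k × ∃[ L ] IsHadamard L × H ⊛ K ᵗ ≈ ((+ s) / 1) • L

MutuallyUnbiased : ∀ {k m} → Vector (SqMatrix k) m → Set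
MutuallyUnbiased H = ∀ i j → i ≢ j → Unbiased (H i) (H j)

-- The order 4n² is written (2n)(2n), so that the indices split into 2n blocks
-- of size 2n.
order : ℕ → ℕ
order n = (2 ℕ.* n) ℕ.* (2 ℕ.* n)

record IsBushType (n : ℕ) (H : SqMatrix (order n)) : Set where
  private
    2n : ℕ
    2n = 2 ℕ.* n

    H[_,_] : Fin 2n → Fin 2n → SqMatrix 2n
    H[ i , j ] = block {2n} {2n} H i j

  field
    hadamard    : IsHadamard H
    diagonal    : ∀ i → H[ i , i ] ≈ J 2n
    offDiagonal : ∀ i j → i ≢ j →
                  H[ i , j ] ⊛ J 2n ≈ O 2n 2n × J 2n ⊛ H[ i , j ] ≈ O 2n 2n

record IsSymmetricAssociationScheme {N} (d : ℕ) (A : Vector (SqMatrix N) (suc d)) : Set where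
  field
    zeroOne   : ∀ i → IsZeroOne (A i)
    nonzero   : ∀ i → ¬ (A i ≈ O N N)
    symmetric : ∀ i → IsSymmetric (A i)
    identity  : A zero ≈ I N
    partition : ∑ᴹ A ≈ J N
    product   : ∀ i j → Σ[ p ∈ Vector ℚ (suc d) ] A i ⊛ A j ≈ ∑ᴹ (λ k → p k • A k)

module Construction (n m : ℕ) where

  2n : ℕ
  2n = 2 ℕ.* n

  N : ℕ
  N = suc m ℕ.* order n

  module _ .{{_ : NonZero n}} (H : Vector (SqMatrix (order n)) m) where

    1/2n : ℚ
    1/2n = _/_ (+ 1) 2n {{m*n≢0 2 n}}

    M : SqMatrix N
    M = blockColumn (I (order n) ∷ λ i → 1/2n • H i)
      ⊛ blockRow (I (order n) ∷ λ i → 1/2n • H i ᵗ)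

    B : SqMatrix N
    B = ((+ 2n) / 1) • (M ⊖ I N)

  record IsSplitting (B B₁ B₂ : SqMatrix N) : Set where
    field
      zeroOne₁   : IsZeroOne B₁
      zeroOne₂   : IsZeroOne B₂
      disjoint   : Disjoint B₁ B₂
      difference : B ≈ B₁ ⊖ B₂

  module _ (B₁ B₂ : SqMatrix N) where

    A₀ A₁ A₂ A₃ A₄ A₅ : SqMatrix N
    A₀ = I N
    A₁ = I (suc m) ⊗ I 2n ⊗ (J 2n ⊖ I 2n)
    A₂ = I (suc m) ⊗ (J 2n ⊖ I 2n) ⊗ J 2n
    A₃ = (J (suc m) ⊖ I (suc m)) ⊗ I 2n ⊗ J 2n
    A₄ = B₁ ⊖ A₃
    A₅ = B₂

    classes : Vector (SqMatrix N) 6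
    classes = A₀ ∷ A₁ ∷ A₂ ∷ A₃ ∷ A₄ ∷ A₅ ∷ []

{-# OPTIONS --safe #-}

-- Put g₀ = I and gₐ = Hₐ/2n.  All gₐ are orthogonal and M has the blocks
-- gₐ gᵦᵗ, so M² = (m+1) M.  By the Bush condition D gₐ = gₐ D = D for both
-- D ∈ {I ⊗ J, J ⊗ J}.  Therefore the product of any two of the six matrices
-- I, P ⊗ D (with P ∈ {I, J}) and M is a scalar multiple of one of them, and
-- these six matrices span the same space as A₀, …, A₅.
module Submission where

open import Defs
open import Algebra.Bundles using (module CommutativeRing)
open import Data.Fin.Base using (Fin; zero; suc; _↑ˡ_; _↑ʳ_; combine; quotient; remainder)
open import Data.Fin.Properties using (_≟_; remQuot-combine; combine-remQuot; combine-injectiveˡ)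
open import Data.Integer.Base using (+_)
import Data.Integer.Base as ℤ
import Data.Integer.Properties as ℤ
open import Data.Nat.Base as ℕ using (ℕ; zero; suc; NonZero; _≤_; s≤s)
import Data.Nat.Properties as ℕ
open import Data.Product.Base using (_×_; _,_; ∃-syntax; Σ-syntax; proj₁; proj₂)
open import Data.Rational.Base using (ℚ; 0ℚ; 1ℚ; ½; _+_; _*_; _-_; -_; _/_; 1/_; ≢-nonZero; nonNegative; toℚᵘ) renaming (_≤_ to _≤ℚ_)
import Data.Rational.Properties as ℚ
open import Algebra.Properties.Semiring.Sum (CommutativeRing.semiring ℚ.+-*-commutativeRing)
  using (∑-distrib-+; ∑-comm; *-distribˡ-sum; *-distribʳ-sum; sum-cong-≗; sum-replicate-zero)
open import Data.Rational.Solver using (module +-*-Solver)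
import Data.Rational.Unnormalised.Base as ℚᵘ
import Data.Rational.Unnormalised.Properties as ℚᵘ
open import Data.Sum.Base using (_⊎_; inj₁; inj₂; [_,_]′; swap)
open import Data.Vec.Functional using (Vector; []; _∷_)
open import Function.Base using (_∘_; case_of_)
open import Relation.Binary.Bundles using (Setoid)
open import Relation.Binary.Definitions using (tri<; tri≈; tri>)
open import Relation.Binary.PropositionalEquality using (_≡_; _≢_; refl; sym; trans; cong; cong₂; subst; subst₂; module ≡-Reasoning)
import Relation.Binary.Reasoning.Setoid as SetoidReasoning
open import Relation.Nullary.Decidable using (Dec; yes; no; dec-true; dec-false)
open import Relation.Nullary.Negation using (¬_; contradiction)
open ≡-Reasoning
open +-*-Solver

-- Numbers

-- The link between `A₄`, `A₅` and M is the support of B. Unbiasedness makes every entry of B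
-- outside the diagonal blocks 1 or -1, so with S = (J - I) ⊗ J ⊗ J any splitting satisfies B₁ + B₂
-- = S and B₁ - B₂ = B. Hence B₁ = (S + B)/2 and B₂ = (S - B)/2, which are combinations of the six
-- generators. Membership in a span is all that is tracked; the structure constants are never
-- computed. Two conditions concern single entries and do not follow from the algebra. For `A₄` to
-- be a (0,1)-matrix, B₁ must be 1 wherever `A₃` is; for `A₄` and `A₅` to be nonzero, B must take
-- both signs in the right places. Both come from sums over column blocks: a row of an off-diagonal
-- block of B sums to 2n over one of its 2n column blocks, so it is constantly 1 there, and to 0
-- over each of the others, so it takes both signs there.

m*m≡n*n⇒m≡n : ∀ {m n} → m ℕ.* m ≡ n ℕ.* n → m ≡ n
m*m≡n*n⇒m≡n {m} {n} eq with ℕ.<-cmp m n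
... | tri< m<n _ _ = contradiction eq (ℕ.<⇒≢ (ℕ.*-mono-< m<n m<n))
... | tri≈ _ m≡n _ = m≡n
... | tri> _ _ m>n = contradiction (sym eq) (ℕ.<⇒≢ (ℕ.*-mono-< m>n m>n))

-- Two different indices below 2n give nonzero entries of `A₁` and `A₂`, and a column in which a
-- given row of I ⊗ J vanishes.
distinctPair : ∀ n .{{_ : NonZero n}} → Σ[ u ∈ Fin (2 ℕ.* n) ] Σ[ v ∈ Fin (2 ℕ.* n) ] u ≢ v
distinctPair (suc n) = u , v , λ u≡v → case combine-injectiveˡ {2} {suc n} zero zero (suc zero) zero u≡v of λ ()
  where
  u v : Fin (2 ℕ.* suc n)
  u = combine {2} {suc n} zero zero
  v = combine {2} {suc n} (suc zero) zero

-- Normalisation by a gcd does not compute for a variable `k`, hence the detour through unnormalised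
-- rationals.
/1-suc : ∀ k → (+ suc k) / 1 ≡ 1ℚ + (+ k) / 1
/1-suc k = ℚ.toℚᵘ-injective (R.begin
  toℚᵘ ((+ suc k) / 1)              R.≈⟨ ℚ.toℚᵘ-fromℚᵘ (ℚᵘ.mkℚᵘ (+ suc k) 0) ⟩
  ℚᵘ.mkℚᵘ (+ suc k) 0
    R.≈⟨ ℚᵘ.*≡* (cong (λ z → (+ 1 ℤ.+ z) ℤ.* + 1) (sym (ℤ.*-identityʳ (+ k)))) ⟩
  ℚᵘ.1ℚᵘ ℚᵘ.+ ℚᵘ.mkℚᵘ (+ k) 0       R.≈⟨ ℚᵘ.+-congʳ ℚᵘ.1ℚᵘ (ℚ.toℚᵘ-fromℚᵘ (ℚᵘ.mkℚᵘ (+ k) 0)) ⟨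
  ℚᵘ.1ℚᵘ ℚᵘ.+ toℚᵘ ((+ k) / 1)      R.≈⟨ ℚ.toℚᵘ-homo-+ 1ℚ ((+ k) / 1) ⟨
  toℚᵘ (1ℚ + (+ k) / 1)             R.∎)
  where module R = SetoidReasoning ℚᵘ.≃-setoid

/1-inverse : ∀ k .{{_ : NonZero k}} → (+ k) / 1 * ((+ 1) / k) ≡ 1ℚ
/1-inverse k@(suc k-1) = ℚ.toℚᵘ-injective (R.begin
  toℚᵘ ((+ k) / 1 * ((+ 1) / k))             R.≈⟨ ℚ.toℚᵘ-homo-* ((+ k) / 1) ((+ 1) / k) ⟩
  toℚᵘ ((+ k) / 1) ℚᵘ.* toℚᵘ ((+ 1) / k)
    R.≈⟨ ℚᵘ.*-cong (ℚ.toℚᵘ-fromℚᵘ (ℚᵘ.mkℚᵘ (+ k) 0)) (ℚ.toℚᵘ-fromℚᵘ (ℚᵘ.mkℚᵘ (+ 1) k-1)) ⟩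
  ℚᵘ.mkℚᵘ (+ k) 0 ℚᵘ.* ℚᵘ.mkℚᵘ (+ 1) k-1
    R.≈⟨ ℚᵘ.*≡* (trans (ℤ.*-identityʳ _) (trans (ℤ.*-identityʳ (+ k))
      (sym (trans (ℤ.*-identityˡ _) (cong +_ (ℕ.*-identityˡ k)))))) ⟩
  ℚᵘ.1ℚᵘ                                     R.∎)
  where module R = SetoidReasoning ℚᵘ.≃-setoid

0≤p*p : ∀ p → 0ℚ ≤ℚ p * p
0≤p*p p = [ nonNeg p , (λ p≤0 → subst (0ℚ ≤ℚ_) (solve 1 (λ x → (:- x) :* (:- x) := x :* x) refl p)
  (nonNeg (- p) (ℚ.neg-antimono-≤ p≤0))) ]′ (ℚ.≤-total 0ℚ p)
  where
  nonNeg : ∀ p → 0ℚ ≤ℚ p → 0ℚ ≤ℚ p * p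
  nonNeg p 0≤p = ℚ.nonNegative⁻¹ (p * p) {{ℚ.nonNeg*nonNeg⇒nonNeg p {{nonNegative 0≤p}} p {{nonNegative 0≤p}}}}

p*p≡0⇒p≡0 : ∀ p → p * p ≡ 0ℚ → p ≡ 0ℚ
p*p≡0⇒p≡0 p p*p≡0 with p ℚ.≟ 0ℚ
... | yes p≡0 = p≡0
... | no  p≢0 = begin
  p                 ≡⟨ ℚ.*-identityʳ p ⟨
  p * 1ℚ            ≡⟨ cong (p *_) (ℚ.*-inverseʳ p) ⟨
  p * (p * 1/ p)    ≡⟨ ℚ.*-assoc p p (1/ p) ⟨
  p * p * 1/ p      ≡⟨ cong (_* 1/ p) p*p≡0 ⟩
  0ℚ * 1/ p         ≡⟨ ℚ.*-zeroˡ (1/ p) ⟩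
  0ℚ                ∎
  where instance _ = ≢-nonZero p≢0

±1-square : ∀ {p} → p ≡ - 1ℚ ⊎ p ≡ 1ℚ → p * p ≡ 1ℚ
±1-square (inj₁ refl) = refl
±1-square (inj₂ refl) = refl

zeroOne-* : ∀ {p r} → p ≡ 0ℚ ⊎ p ≡ 1ℚ → r ≡ 0ℚ ⊎ r ≡ 1ℚ → p * r ≡ 0ℚ ⊎ p * r ≡ 1ℚ
zeroOne-* {r = r} (inj₁ refl) _ = inj₁ (ℚ.*-zeroˡ r)
zeroOne-* {r = r} (inj₂ refl) r-cases = subst (λ p → p ≡ 0ℚ ⊎ p ≡ 1ℚ) (sym (ℚ.*-identityˡ r)) r-cases

zeroOne-1- : ∀ {p} → p ≡ 0ℚ ⊎ p ≡ 1ℚ → 1ℚ - p ≡ 0ℚ ⊎ 1ℚ - p ≡ 1ℚ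
zeroOne-1- (inj₁ refl) = inj₂ refl
zeroOne-1- (inj₂ refl) = inj₁ refl

-- The first factor is 0 or 2. These products are the summands of the positivity argument in `Bᵇ-E`.
0≤[1-±1]*[0,1] : ∀ {p r} → p ≡ - 1ℚ ⊎ p ≡ 1ℚ → r ≡ 0ℚ ⊎ r ≡ 1ℚ → 0ℚ ≤ℚ (1ℚ - p) * r
0≤[1-±1]*[0,1] (inj₁ refl) (inj₁ refl) = ℚ.nonNegative⁻¹ _
0≤[1-±1]*[0,1] (inj₁ refl) (inj₂ refl) = ℚ.nonNegative⁻¹ _
0≤[1-±1]*[0,1] (inj₂ refl) (inj₁ refl) = ℚ.nonNegative⁻¹ _
0≤[1-±1]*[0,1] (inj₂ refl) (inj₂ refl) = ℚ.nonNegative⁻¹ _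

1≢0 : 1ℚ ≢ 0ℚ
1≢0 ()

-1≢0 : - 1ℚ ≢ 0ℚ
-1≢0 ()

-- The positive and the negative part of `p`, written as polynomials because |p| = p² for these
-- values.
halves : ∀ {p} → p ≡ 0ℚ ⊎ p ≡ 1ℚ ⊎ p ≡ - 1ℚ → let p⁺ = ½ * (p * p + p) ; p⁻ = ½ * (p * p - p) in
  (p⁺ ≡ 0ℚ ⊎ p⁺ ≡ 1ℚ) × (p⁻ ≡ 0ℚ ⊎ p⁻ ≡ 1ℚ) × ¬ (p⁺ ≡ 1ℚ × p⁻ ≡ 1ℚ)
halves (inj₁ refl)        = inj₁ refl , inj₁ refl , λ ()
halves (inj₂ (inj₁ refl)) = inj₂ refl , inj₁ refl , λ ()
halves (inj₂ (inj₂ refl)) = inj₁ refl , inj₂ refl , λ ()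

-- Disjointness means p r = 0, and p² = p, r² = r, so (p - r)² = p + r. Thus the sum of the two
-- parts of a splitting is determined by B.
sum≡square : ∀ {p r s} → p ≡ 0ℚ ⊎ p ≡ 1ℚ → r ≡ 0ℚ ⊎ r ≡ 1ℚ → ¬ (p ≡ 1ℚ × r ≡ 1ℚ) → s ≡ p - r → p + r ≡ s * s
sum≡square (inj₁ refl) (inj₁ refl) _   refl = refl
sum≡square (inj₁ refl) (inj₂ refl) _   refl = refl
sum≡square (inj₂ refl) (inj₁ refl) _   refl = refl
sum≡square (inj₂ refl) (inj₂ refl) p≢r _    = contradiction (refl , refl) p≢r

-- Finite sums

∑-ones : ∀ k → ∑ {k} (λ _ → 1ℚ) ≡ (+ k) / 1
∑-ones zero    = refl
∑-ones (suc k) = trans (cong (λ z → 1ℚ + z) (∑-ones k)) (sym (/1-suc k))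

∑-const : ∀ k q → ∑ {k} (λ _ → q) ≡ ((+ k) / 1) * q
∑-const k q = begin
  ∑ {k} (λ _ → q)            ≡⟨ sum-cong-≗ {k} (λ _ → sym (ℚ.*-identityˡ q)) ⟩
  ∑ {k} (λ _ → 1ℚ * q)       ≡⟨ *-distribʳ-sum {k} q (λ _ → 1ℚ) ⟨
  ∑ {k} (λ _ → 1ℚ) * q       ≡⟨ cong (_* q) (∑-ones k) ⟩
  ((+ k) / 1) * q            ∎

∑-zero : ∀ {k} {f : Vector ℚ k} → (∀ i → f i ≡ 0ℚ) → ∑ f ≡ 0ℚ
∑-zero {k} f≡0 = trans (sum-cong-≗ f≡0) (sum-replicate-zero k)

∑-linear : ∀ {k} p q (f g : Vector ℚ k) → ∑ (λ i → p * f i + q * g i) ≡ p * ∑ f + q * ∑ g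
∑-linear p q f g = trans (∑-distrib-+ (λ i → p * f i) (λ i → q * g i))
  (cong₂ _+_ (sym (*-distribˡ-sum p f)) (sym (*-distribˡ-sum q g)))

∑-nonNeg : ∀ {k} {f : Vector ℚ k} → (∀ i → 0ℚ ≤ℚ f i) → 0ℚ ≤ℚ ∑ f
∑-nonNeg {zero}  0≤f = ℚ.≤-refl
∑-nonNeg {suc k} 0≤f = ℚ.+-mono-≤ (0≤f zero) (∑-nonNeg (0≤f ∘ suc))

-- The head lies between 0 and the whole sum, so it vanishes and leaves a tail of sum 0. Squares of
-- entries are treated this way in `orthogonal-ᵗ`, deviations from 1 in `Bᵇ-E`.
∑-nonNeg-zero : ∀ {k} {f : Vector ℚ k} → (∀ i → 0ℚ ≤ℚ f i) → ∑ f ≡ 0ℚ → ∀ i → f i ≡ 0ℚ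
∑-nonNeg-zero {suc k} {f} 0≤f ∑f≡0 = λ { zero → f₀≡0 ; (suc i) → ∑-nonNeg-zero (0≤f ∘ suc) ∑tail≡0 i }
  where
  f₀≡0 : f zero ≡ 0ℚ
  f₀≡0 = ℚ.≤-antisym
    (subst₂ _≤ℚ_ (ℚ.+-identityʳ (f zero)) ∑f≡0 (ℚ.+-monoʳ-≤ (f zero) (∑-nonNeg (0≤f ∘ suc))))
    (0≤f zero)

  ∑tail≡0 : ∑ (f ∘ suc) ≡ 0ℚ
  ∑tail≡0 = trans (sym (ℚ.+-identityˡ _)) (trans (cong (_+ ∑ (f ∘ suc)) (sym f₀≡0)) ∑f≡0)

∑-++ : ∀ r {c} (f : Vector ℚ (r ℕ.+ c)) → ∑ f ≡ ∑ (λ i → f (i ↑ˡ c)) + ∑ (λ j → f (r ↑ʳ j))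
∑-++ zero    f = sym (ℚ.+-identityˡ _)
∑-++ (suc r) f = trans (cong (λ s → f zero + s) (∑-++ r (f ∘ suc))) (sym (ℚ.+-assoc (f zero) _ _))

∑-combine : ∀ r {c} (f : Vector ℚ (r ℕ.* c)) → ∑ f ≡ ∑ λ a → ∑ λ x → f (combine {r} {c} a x)
∑-combine zero        f = refl
∑-combine (suc r) {c} f = trans (∑-++ c f) (cong (λ s → ∑ (λ x → f (x ↑ˡ (r ℕ.* c))) + s) (∑-combine r (λ j → f (c ↑ʳ j))))

∑-remQuot : ∀ {r c} (f : Fin r → Fin c → ℚ) →
  ∑ (λ i → f (quotient c i) (remainder {r} c i)) ≡ ∑ λ a → ∑ λ x → f a x
∑-remQuot {r} {c} f = trans (∑-combine r _) (sum-cong-≗ λ a → sum-cong-≗ λ x →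
  cong (λ ax → f (proj₁ ax) (proj₂ ax)) (remQuot-combine a x))

-- Matrix algebra

≈-refl : ∀ {r c} {A : Matrix r c} → A ≈ A
≈-refl i j = refl

≈-sym : ∀ {r c} {A B : Matrix r c} → A ≈ B → B ≈ A
≈-sym A≈B i j = sym (A≈B i j)

≈-trans : ∀ {r c} {A B C : Matrix r c} → A ≈ B → B ≈ C → A ≈ C
≈-trans A≈B B≈C i j = trans (A≈B i j) (B≈C i j)

≈-setoid : ∀ r c → Setoid _ _
≈-setoid r c = record
  { Carrier       = Matrix r c
  ; _≈_           = _≈_
  ; isEquivalence = record
    { refl  = λ {A} → ≈-refl {A = A}
    ; sym   = ≈-sym
    ; trans = ≈-trans
    }
  }

⊛-cong : ∀ {r s c} {A A′ : Matrix r s} {B B′ : Matrix s c} → A ≈ A′ → B ≈ B′ → A ⊛ B ≈ A′ ⊛ B′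
⊛-cong A≈A′ B≈B′ i j = sum-cong-≗ λ l → cong₂ _*_ (A≈A′ i l) (B≈B′ l j)

1•-identity : ∀ {r c} (A : Matrix r c) → A ≈ 1ℚ • A
1•-identity A i j = sym (ℚ.*-identityˡ (A i j))

⊛-assoc : ∀ {r s t c} (A : Matrix r s) (B : Matrix s t) (C : Matrix t c) → (A ⊛ B) ⊛ C ≈ A ⊛ (B ⊛ C)
⊛-assoc A B C i j = begin
  ∑ (λ l → ∑ (λ h → A i h * B h l) * C l j)
    ≡⟨ sum-cong-≗ (λ l → *-distribʳ-sum (C l j) (λ h → A i h * B h l)) ⟩
  ∑ (λ l → ∑ (λ h → A i h * B h l * C l j))        ≡⟨ ∑-comm (λ l h → A i h * B h l * C l j) ⟩
  ∑ (λ h → ∑ (λ l → A i h * B h l * C l j))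
    ≡⟨ sum-cong-≗ (λ h → sum-cong-≗ λ l → ℚ.*-assoc (A i h) (B h l) (C l j)) ⟩
  ∑ (λ h → ∑ (λ l → A i h * (B h l * C l j)))
    ≡⟨ sum-cong-≗ (λ h → sym (*-distribˡ-sum (A i h) (λ l → B h l * C l j))) ⟩
  ∑ (λ h → A i h * ∑ (λ l → B h l * C l j))        ∎

⊛-ᵗ : ∀ {r s c} (A : Matrix r s) (B : Matrix s c) → (A ⊛ B) ᵗ ≈ B ᵗ ⊛ A ᵗ
⊛-ᵗ A B i j = sum-cong-≗ λ l → ℚ.*-comm (A j l) (B l i)

⊛-•ˡ : ∀ {r s c} q (A : Matrix r s) (B : Matrix s c) → (q • A) ⊛ B ≈ q • (A ⊛ B)
⊛-•ˡ q A B i j = trans (sum-cong-≗ λ l → ℚ.*-assoc q (A i l) (B l j)) (sym (*-distribˡ-sum q (λ l → A i l * B l j)))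

⊛-•ʳ : ∀ {r s c} q (A : Matrix r s) (B : Matrix s c) → A ⊛ (q • B) ≈ q • (A ⊛ B)
⊛-•ʳ q A B i j = trans
  (sum-cong-≗ λ l → solve 3 (λ x y z → x :* (y :* z) := y :* (x :* z)) refl (A i l) q (B l j))
  (sym (*-distribˡ-sum q (λ l → A i l * B l j)))

I-diagonal : ∀ {k} {i j : Fin k} → i ≡ j → I k i j ≡ 1ℚ
I-diagonal {k} {i} {j} i≡j rewrite dec-true (i ≟ j) i≡j = refl

I-offDiagonal : ∀ {k} {i j : Fin k} → i ≢ j → I k i j ≡ 0ℚ
I-offDiagonal {k} {i} {j} i≢j rewrite dec-false (i ≟ j) i≢j = refl

I-sym : ∀ k → IsSymmetric (I k)
I-sym k i j with i ≟ j
... | yes i≡j = I-diagonal (sym i≡j)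
... | no  i≢j = I-offDiagonal (i≢j ∘ sym)

I-zeroOne : ∀ k → IsZeroOne (I k)
I-zeroOne k i j with i ≟ j
... | yes _ = inj₂ refl
... | no  _ = inj₁ refl

∑-I : ∀ {k} i (f : Vector ℚ k) → ∑ (λ l → I k i l * f l) ≡ f i
∑-I {suc k} zero    f = trans (cong₂ _+_ (ℚ.*-identityˡ (f zero)) (∑-zero λ l → ℚ.*-zeroˡ (f (suc l)))) (ℚ.+-identityʳ (f zero))
-- `I (suc k) (suc i) (suc l)` computes to `I k i l`, as `does` commutes with the comparison of
-- successors.
∑-I {suc k} (suc i) f = trans (cong₂ _+_ (ℚ.*-zeroˡ (f zero)) (∑-I i (f ∘ suc))) (ℚ.+-identityˡ (f (suc i)))

⊛-identityˡ : ∀ {r c} (A : Matrix r c) → I r ⊛ A ≈ A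
⊛-identityˡ A i j = ∑-I i (λ l → A l j)

⊛-identityʳ : ∀ {r c} (A : Matrix r c) → A ⊛ I c ≈ A
⊛-identityʳ {c = c} A i j = trans (sum-cong-≗ λ l → trans (ℚ.*-comm (A i l) (I c l j)) (cong (_* A i l) (I-sym c j l))) (∑-I j (A i))

J⊛J : ∀ k → J k ⊛ J k ≈ ((+ k) / 1) • J k
J⊛J k i j = ∑-const k (1ℚ * 1ℚ)

-- A relation between entries rather than an operation: `Z` may be any matrix that is only pointwise
-- equal to the combination, so no function extensionality is needed.
IsCombination : ∀ {r c} → ℚ → ℚ → Matrix r c → Matrix r c → Matrix r c → Set
IsCombination p q X Y Z = ∀ i j → Z i j ≡ p * X i j + q * Y i j

Linear : ∀ {r c r′ c′} → (Matrix r c → Matrix r′ c′) → Set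
Linear f = ∀ p q {X Y Z} → IsCombination p q X Y Z → IsCombination p q (f X) (f Y) (f Z)

⊛-linearˡ : ∀ {r s c} (B : Matrix s c) → Linear {r} (_⊛ B)
⊛-linearˡ B p q {X} {Y} Z≡ i j = trans
  (sum-cong-≗ λ l → trans (cong (_* B l j) (Z≡ i l))
    (solve 5 (λ p q x y b → (p :* x :+ q :* y) :* b := p :* (x :* b) :+ q :* (y :* b)) refl p q (X i l) (Y i l) (B l j)))
  (∑-linear p q (λ l → X i l * B l j) (λ l → Y i l * B l j))

⊛-linearʳ : ∀ {r s c} (A : Matrix r s) → Linear {c = c} (A ⊛_)
⊛-linearʳ A p q {X} {Y} Z≡ i j = trans
  (sum-cong-≗ λ l → trans (cong (A i l *_) (Z≡ l j))
    (solve 5 (λ p q x y a → a :* (p :* x :+ q :* y) := p :* (a :* x) :+ q :* (a :* y)) refl p q (X l j) (Y l j) (A i l)))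
  (∑-linear p q (λ l → A i l * X l j) (λ l → A i l * Y l j))

-- For a matrix A with orthonormal rows, Z = I − AᵗA is a symmetric
-- idempotent of trace 0, so the squares of its entries sum to 0.
orthogonal-ᵗ : ∀ {k} (A : SqMatrix k) → A ⊛ A ᵗ ≈ I k → A ᵗ ⊛ A ≈ I k
orthogonal-ᵗ {k} A AAᵗ≈I i j = begin
  P i j                    ≡⟨ solve 2 (λ x y → x := y :- (y :- x)) refl (P i j) (I k i j) ⟩
  I k i j - Z i j          ≡⟨ cong (λ z → I k i j - z) Zᵢⱼ≡0 ⟩
  I k i j - 0ℚ             ≡⟨ ℚ.+-identityʳ (I k i j) ⟩
  I k i j                  ∎
  where
  P Z : SqMatrix k
  P = A ᵗ ⊛ A
  Z = I k ⊖ P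

  Z≡I-P : IsCombination 1ℚ (- 1ℚ) (I k) P Z
  Z≡I-P h l = solve 2 (λ x y → x :- y := con 1ℚ :* x :+ con (- 1ℚ) :* y) refl (I k h l) (P h l)

  PP≈P : P ⊛ P ≈ P
  PP≈P = ≈-trans (⊛-assoc (A ᵗ) A P) (⊛-cong {A = A ᵗ} ≈-refl
    (≈-trans (≈-sym (⊛-assoc A (A ᵗ) A)) (≈-trans (⊛-cong {B = A} AAᵗ≈I ≈-refl) (⊛-identityˡ A))))

  PZ≈O : P ⊛ Z ≈ O k k
  PZ≈O h l = begin
    (P ⊛ Z) h l                                      ≡⟨ ⊛-linearʳ P 1ℚ (- 1ℚ) {I k} {P} {Z} Z≡I-P h l ⟩
    1ℚ * (P ⊛ I k) h l + (- 1ℚ) * (P ⊛ P) h l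
      ≡⟨ cong₂ (λ x y → 1ℚ * x + (- 1ℚ) * y) (⊛-identityʳ P h l) (PP≈P h l) ⟩
    1ℚ * P h l + (- 1ℚ) * P h l
      ≡⟨ solve 1 (λ x → con 1ℚ :* x :+ con (- 1ℚ) :* x := con 0ℚ) refl (P h l) ⟩
    0ℚ                                               ∎

  ZZ≈Z : Z ⊛ Z ≈ Z
  ZZ≈Z h l = begin
    (Z ⊛ Z) h l                                      ≡⟨ ⊛-linearˡ Z 1ℚ (- 1ℚ) {I k} {P} {Z} Z≡I-P h l ⟩
    1ℚ * (I k ⊛ Z) h l + (- 1ℚ) * (P ⊛ Z) h l
      ≡⟨ cong₂ (λ x y → 1ℚ * x + (- 1ℚ) * y) (⊛-identityˡ Z h l) (PZ≈O h l) ⟩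
    1ℚ * Z h l + (- 1ℚ) * 0ℚ
      ≡⟨ solve 1 (λ x → con 1ℚ :* x :+ con (- 1ℚ) :* con 0ℚ := x) refl (Z h l) ⟩
    Z h l                                            ∎

  Z-sym : IsSymmetric Z
  Z-sym h l = cong₂ _-_ (I-sym k h l) (⊛-ᵗ (A ᵗ) A h l)

  trace≡0 : ∑ (λ h → Z h h) ≡ 0ℚ
  trace≡0 = begin
    ∑ (λ h → Z h h)
      ≡⟨ sum-cong-≗ (λ h → Z≡I-P h h) ⟩
    ∑ (λ h → 1ℚ * I k h h + (- 1ℚ) * P h h)
      ≡⟨ ∑-linear 1ℚ (- 1ℚ) (λ h → I k h h) (λ h → P h h) ⟩
    1ℚ * ∑ (λ h → I k h h) + (- 1ℚ) * ∑ (λ h → ∑ (λ l → A l h * A l h))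
      -- Exchanging the sums is tr(AᵗA) = tr(AAᵗ), and AAᵗ is the identity.
      ≡⟨ cong (λ z → 1ℚ * ∑ (λ h → I k h h) + (- 1ℚ) * z) (trans (∑-comm (λ h l → A l h * A l h)) (sum-cong-≗ λ l → AAᵗ≈I l l)) ⟩
    1ℚ * ∑ (λ h → I k h h) + (- 1ℚ) * ∑ (λ h → I k h h)
      ≡⟨ solve 1 (λ x → con 1ℚ :* x :+ con (- 1ℚ) :* x := con 0ℚ) refl (∑ (λ h → I k h h)) ⟩
    0ℚ ∎

  ∑Z²≡0 : ∑ (λ h → ∑ (λ l → Z h l * Z h l)) ≡ 0ℚ
  ∑Z²≡0 = trans
    (sum-cong-≗ λ h → trans (sum-cong-≗ λ l → cong (Z h l *_) (sym (Z-sym h l))) (ZZ≈Z h h))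
    trace≡0

  Zᵢⱼ≡0 : Z i j ≡ 0ℚ
  Zᵢⱼ≡0 = p*p≡0⇒p≡0 (Z i j) (∑-nonNeg-zero (λ l → 0≤p*p (Z i l))
    (∑-nonNeg-zero (λ h → ∑-nonNeg λ l → 0≤p*p (Z h l)) ∑Z²≡0 i) j)

-- Kronecker products and block matrices

-- `A ⊗ B` is definitionally `blocks (λ a b → A a b • B)`, so one rule for block multiplication
-- serves Kronecker products, the Gram matrix and their mixed products.
blocks : ∀ {a b r c} → (Fin a → Fin b → Matrix r c) → Matrix (a ℕ.* r) (b ℕ.* c)
blocks {a} {b} {r} {c} F i j = F (quotient r i) (quotient c j) (remainder {a} r i) (remainder {b} c j)

blocks-cong : ∀ {a b r c} {F G : Fin a → Fin b → Matrix r c} → (∀ x y → F x y ≈ G x y) → blocks F ≈ blocks G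
blocks-cong {a} {b} {r} {c} F≈G i j = F≈G (quotient r i) (quotient c j) (remainder {a} r i) (remainder {b} c j)

blocks-combine : ∀ {a b r c} (F : Fin a → Fin b → Matrix r c) x y i j →
  blocks F (combine x i) (combine y j) ≡ F x y i j
blocks-combine {a} {b} {r} {c} F x y i j = cong₂ (λ p q → F (proj₁ p) (proj₁ q) (proj₂ p) (proj₂ q))
  (remQuot-combine {a} {r} x i) (remQuot-combine {b} {c} y j)

blocks-⊛ : ∀ {a b d r s c} (F : Fin a → Fin b → Matrix r s) (G : Fin b → Fin d → Matrix s c) →
  blocks F ⊛ blocks G ≈ blocks λ x y → ∑ᴹ λ z → F x z ⊛ G z y
blocks-⊛ {a} {d = d} {r} {c = c} F G i j = ∑-remQuot λ z l →
  F (quotient r i) z (remainder {a} r i) l * G z (quotient c j) l (remainder {d} c j)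

⊗-combine : ∀ {r c r′ c′} (A : Matrix r c) (B : Matrix r′ c′) a b x y →
  (A ⊗ B) (combine a x) (combine b y) ≡ A a b * B x y
⊗-combine A B a b x y = blocks-combine (λ a b → A a b • B) a b x y

⊗-sym : ∀ {r c} {A : SqMatrix r} {B : SqMatrix c} → IsSymmetric A → IsSymmetric B → IsSymmetric (A ⊗ B)
⊗-sym {r} {c} A-sym B-sym i j = cong₂ _*_
  (A-sym (quotient c i) (quotient c j)) (B-sym (remainder {r} c i) (remainder {r} c j))

⊗-⊛ : ∀ {r s c r′ s′ c′} (A : Matrix r s) (B : Matrix r′ s′) (C : Matrix s c) (D : Matrix s′ c′) →
  (A ⊗ B) ⊛ (C ⊗ D) ≈ (A ⊛ C) ⊗ (B ⊛ D)
⊗-⊛ A B C D = ≈-trans (blocks-⊛ (λ a b → A a b • B) (λ a b → C a b • D)) (blocks-cong λ a b x y → begin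
  ∑ (λ z → ∑ (λ l → (A a z * B x l) * (C z b * D l y)))
    ≡⟨ sum-cong-≗ (λ z → sum-cong-≗ λ l → solve 4 (λ p q r s → (p :* q) :* (r :* s) := (p :* r) :* (q :* s)) refl (A a z) (B x l) (C z b) (D l y)) ⟩
  ∑ (λ z → ∑ (λ l → (A a z * C z b) * (B x l * D l y)))
    ≡⟨ sum-cong-≗ (λ z → sym (*-distribˡ-sum (A a z * C z b) (λ l → B x l * D l y))) ⟩
  ∑ (λ z → (A a z * C z b) * (B ⊛ D) x y)
    ≡⟨ *-distribʳ-sum ((B ⊛ D) x y) (λ z → A a z * C z b) ⟨
  (A ⊛ C) a b * (B ⊛ D) x y                               ∎)

⊗-scaledˡ : ∀ {r c r′ c′} p (A B : Matrix r c) (C : Matrix r′ c′) → A ≈ p • B → A ⊗ C ≈ p • (B ⊗ C)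
⊗-scaledˡ {r} {c} {r′} {c′} p A B C A≈pB i j = trans
  (cong (_* C x y) (A≈pB a b)) (ℚ.*-assoc p (B a b) (C x y))
  where
  a = quotient r′ i
  b = quotient c′ j
  x = remainder {r} r′ i
  y = remainder {c} c′ j

⊗-⊛-scaled : ∀ {k l} p q (A B C : SqMatrix k) (A′ B′ C′ : SqMatrix l) →
  A ⊛ B ≈ p • C → A′ ⊛ B′ ≈ q • C′ → (A ⊗ A′) ⊛ (B ⊗ B′) ≈ (p * q) • (C ⊗ C′)
⊗-⊛-scaled {k} {l} p q A B C A′ B′ C′ AB≈pC A′B′≈qC′ i j = begin
  ((A ⊗ A′) ⊛ (B ⊗ B′)) i j             ≡⟨ ⊗-⊛ A A′ B B′ i j ⟩
  (A ⊛ B) a b * (A′ ⊛ B′) x y           ≡⟨ cong₂ _*_ (AB≈pC a b) (A′B′≈qC′ x y) ⟩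
  (p * C a b) * (q * C′ x y)
    ≡⟨ solve 4 (λ p q c d → (p :* c) :* (q :* d) := (p :* q) :* (c :* d)) refl p q (C a b) (C′ x y) ⟩
  p * q * (C a b * C′ x y)              ∎
  where
  a = quotient l i
  b = quotient l j
  x = remainder {k} l i
  y = remainder {k} l j

-- An index of the product is determined by its quotient and remainder. This lets `I N` be compared
-- block by block with the Kronecker products.
I⊗I : ∀ r c → I r ⊗ I c ≈ I (r ℕ.* c)
I⊗I r c i j = go (quotient c i ≟ quotient c j) (remainder {r} c i ≟ remainder {r} c j)
  where
  go : Dec (quotient {r} c i ≡ quotient c j) → Dec (remainder {r} c i ≡ remainder {r} c j) →
    (I r ⊗ I c) i j ≡ I (r ℕ.* c) i j
  go (no ¬p) _ = trans
    (trans (cong (_* I c (remainder {r} c i) (remainder {r} c j)) (I-offDiagonal ¬p)) (ℚ.*-zeroˡ (I c (remainder {r} c i) (remainder {r} c j))))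
    (sym (I-offDiagonal (¬p ∘ cong (quotient {r} c))))
  go (yes p) (no ¬q) = trans
    (trans (cong (I r (quotient c i) (quotient c j) *_) (I-offDiagonal ¬q)) (ℚ.*-zeroʳ (I r (quotient c i) (quotient c j))))
    (sym (I-offDiagonal (¬q ∘ cong (remainder {r} c))))
  go (yes p) (yes q) = trans (cong₂ _*_ (I-diagonal p) (I-diagonal q))
    (sym (I-diagonal (trans (sym (combine-remQuot {r} c i))
      (trans (cong₂ combine p q) (combine-remQuot {r} c j)))))

-- Linear spans

-- Membership is a derivation tree without a coefficient vector, so linear maps act on it by
-- recursion; `span⇒coefficients` recovers coefficients at the very end.
data Span {r c} {Index : Set} (A : Index → Matrix r c) : Matrix r c → Set where
  generator   : ∀ i → Span A (A i)
  combination : ∀ p q {X Y Z} → Span A X → Span A Y → IsCombination p q X Y Z → Span A Z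

span-resp-≈ : ∀ {r c} {Index : Set} {A : Index → Matrix r c} {X Z} → Span A X → Z ≈ X → Span A Z
span-resp-≈ {X = X} X∈ Z≈X = combination 1ℚ 0ℚ X∈ X∈ λ i j →
  trans (Z≈X i j) (solve 1 (λ x → x := con 1ℚ :* x :+ con 0ℚ :* x) refl (X i j))

span-• : ∀ {r c} {Index : Set} {A : Index → Matrix r c} q {X} → Span A X → Span A (q • X)
span-• q {X} X∈ = combination q 0ℚ X∈ X∈ λ i j →
  solve 2 (λ q x → q :* x := q :* x :+ con 0ℚ :* x) refl q (X i j)

span-map : ∀ {r c r′ c′} {Index Index′ : Set} {A : Index → Matrix r c} {A′ : Index′ → Matrix r′ c′}
  {f : Matrix r c → Matrix r′ c′} → Linear f → (∀ i → Span A′ (f (A i))) → ∀ {X} → Span A X → Span A′ (f X)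
span-map f-linear fA∈ (generator i)             = fA∈ i
span-map f-linear fA∈ (combination p q X∈ Y∈ Z≡) =
  combination p q (span-map f-linear fA∈ X∈) (span-map f-linear fA∈ Y∈) (f-linear p q Z≡)

-- Bilinearity: the left factor is expanded over the generators, then the right one. The target
-- family differs from the source because products of generators are to land in the span of the
-- classes.
span-⊛ : ∀ {k} {Index Index′ : Set} {A : Index → SqMatrix k} {A′ : Index′ → SqMatrix k} →
  (∀ i j → Span A′ (A i ⊛ A j)) → ∀ {X Y} → Span A X → Span A Y → Span A′ (X ⊛ Y)
span-⊛ {A = A} AA∈ {Y = Y} X∈ Y∈ = span-map (⊛-linearˡ Y) (λ i → span-map (⊛-linearʳ (A i)) (AA∈ i) Y∈) X∈

span⇒coefficients : ∀ {r c k} {A : Vector (Matrix r c) k} {X} → Span A X →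
  Σ[ p ∈ Vector ℚ k ] X ≈ ∑ᴹ (λ l → p l • A l)
-- Row `i` of the identity matrix serves as the unit coefficient vector.
span⇒coefficients {A = A} (generator i) = I _ i , λ x y → sym (∑-I i (λ l → A l x y))
span⇒coefficients {A = A} (combination p q X∈ Y∈ Z≡) with span⇒coefficients X∈ | span⇒coefficients Y∈
... | u , X≡ | v , Y≡ = (λ l → p * u l + q * v l) , λ x y → trans (Z≡ x y) (trans
  (cong₂ (λ s t → p * s + q * t) (X≡ x y) (Y≡ x y))
  (trans (sym (∑-linear p q (λ l → u l * A l x y) (λ l → v l * A l x y))) (sum-cong-≗ λ l →
    solve 5 (λ p q u v a → p :* (u :* a) :+ q :* (v :* a) := (p :* u :+ q :* v) :* a) refl p q (u l) (v l) (A l x y))))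

-- The algebra spanned by I and J

IJ : ∀ k → Vector (SqMatrix k) 2
IJ k = I k ∷ J k ∷ []

IJ-sym : ∀ k p → IsSymmetric (IJ k p)
IJ-sym k zero       = I-sym k
IJ-sym k (suc zero) = λ i j → refl

IJ-⊛ : ∀ k p q → ∃[ c ] ∃[ l ] IJ k p ⊛ IJ k q ≈ c • IJ k l
IJ-⊛ k zero       q          = 1ℚ , q , ≈-trans (⊛-identityˡ (IJ k q)) (1•-identity (IJ k q))
IJ-⊛ k (suc zero) zero       = 1ℚ , suc zero , ⊛-identityʳ (J k)
IJ-⊛ k (suc zero) (suc zero) = ((+ k) / 1) , suc zero , J⊛J k

module Scheme (n m : ℕ) .{{_ : NonZero n}} (H : Vector (SqMatrix (order n)) m)
  (bush : ∀ i → IsBushType n (H i)) (unbiased : MutuallyUnbiased H) where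

  open Construction n m
  open IsBushType
  open IsHadamard

  q κ : ℚ
  q = 1/2n H
  κ = (+ 2n) / 1

  κ*q≡1 : κ * q ≡ 1ℚ
  κ*q≡1 = /1-inverse 2n {{ℕ.m*n≢0 2 n}}

  κ*[q*p]≡p : ∀ p → κ * (q * p) ≡ p
  κ*[q*p]≡p p = trans (sym (ℚ.*-assoc κ q p)) (trans (cong (_* p) κ*q≡1) (ℚ.*-identityˡ p))

  q*[κ*p]≡p : ∀ p → q * (κ * p) ≡ p
  q*[κ*p]≡p p = trans (solve 3 (λ q κ p → q :* (κ :* p) := κ :* (q :* p)) refl q κ p) (κ*[q*p]≡p p)

  κ-cancel : ∀ {p r} → κ * p ≡ κ * r → p ≡ r
  κ-cancel {p} {r} eq = trans (sym (q*[κ*p]≡p p)) (trans (cong (q *_) eq) (q*[κ*p]≡p r))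

  -- The matrices I ⊗ J and J ⊗ J and the Bush condition

  D : Fin 2 → SqMatrix (order n)
  D d = IJ 2n d ⊗ J 2n

  E : SqMatrix (order n)
  E = D zero

  D-sym : ∀ d → IsSymmetric (D d)
  D-sym d = ⊗-sym {A = IJ 2n d} {B = J 2n} (IJ-sym 2n d) (λ i j → refl)

  D⊛D : ∀ d e → ∃[ c ] ∃[ f ] D d ⊛ D e ≈ c • D f
  D⊛D d e = scaled (IJ-⊛ 2n d e)
    where
    scaled : (∃[ c ] ∃[ f ] IJ 2n d ⊛ IJ 2n e ≈ c • IJ 2n f) → ∃[ c ] ∃[ f ] D d ⊛ D e ≈ c • D f
    scaled (c , f , eq) = c * κ , f ,
      ⊗-⊛-scaled c κ (IJ 2n d) (IJ 2n e) (IJ 2n f) (J 2n) (J 2n) (J 2n) eq (J⊛J 2n)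

  D⊛E : ∀ d → D d ⊛ E ≈ κ • D d
  D⊛E d i j = trans
    (⊗-⊛-scaled 1ℚ κ (IJ 2n d) (I 2n) (IJ 2n d) (J 2n) (J 2n) (J 2n)
      (≈-trans (⊛-identityʳ (IJ 2n d)) (1•-identity (IJ 2n d))) (J⊛J 2n) i j)
    (cong (_* D d i j) (ℚ.*-identityˡ κ))

  pos : Fin 2n → Fin 2n → Fin (order n)
  pos = combine

  -- Row `x` of `E` is the indicator of the block containing `x`, so an entry of `E ⊛ W` is a column
  -- sum inside one block: 2n in a diagonal block, 0 in any other. Only column sums enter the
  -- hypotheses, so that both H and its transpose qualify.
  E⊛bush : (W : SqMatrix (order n)) → (∀ i → block {2n} {2n} W i i ≈ J 2n) →
    (∀ i j → i ≢ j → J 2n ⊛ block {2n} {2n} W i j ≈ O 2n 2n) → E ⊛ W ≈ κ • E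
  E⊛bush W diag off x y = begin
    ∑ (λ l → E x l * W l y)
      ≡⟨ ∑-combine 2n (λ l → E x l * W l y) ⟩
    ∑ (λ a → ∑ (λ z → E x (pos a z) * W (pos a z) y))
      ≡⟨ sum-cong-≗ (λ a → sum-cong-≗ λ z → cong (_* W (pos a z) y)
           (trans (ℚ.*-identityʳ (I 2n x₁ (quotient 2n (pos a z)))) (cong (λ p → I 2n x₁ (proj₁ p)) (remQuot-combine {2n} {2n} a z)))) ⟩
    ∑ (λ a → ∑ (λ z → I 2n x₁ a * W (pos a z) y))
      ≡⟨ sum-cong-≗ (λ a → sym (*-distribˡ-sum (I 2n x₁ a) (λ z → W (pos a z) y))) ⟩
    ∑ (λ a → I 2n x₁ a * ∑ (λ z → W (pos a z) y))
      ≡⟨ ∑-I x₁ (λ a → ∑ (λ z → W (pos a z) y)) ⟩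
    ∑ (λ z → W (pos x₁ z) y)
      ≡⟨ cong (λ y → ∑ (λ z → W (pos x₁ z) y)) (sym (combine-remQuot {2n} 2n y)) ⟩
    ∑ (λ z → W (pos x₁ z) (pos y₁ y₂))
      ≡⟨ columnSum (x₁ ≟ y₁) ⟩
    κ * (I 2n x₁ y₁ * 1ℚ) ∎
    where
    x₁ = quotient {2n} 2n x
    y₁ = quotient {2n} 2n y
    y₂ = remainder {2n} 2n y

    columnSum : Dec (x₁ ≡ y₁) → ∑ (λ z → W (pos x₁ z) (pos y₁ y₂)) ≡ κ * (I 2n x₁ y₁ * 1ℚ)
    columnSum (yes x₁≡y₁) = begin
      ∑ (λ z → W (pos x₁ z) (pos y₁ y₂))
        ≡⟨ sum-cong-≗ (λ z → trans (cong (λ a → W (pos a z) (pos y₁ y₂)) x₁≡y₁) (diag y₁ z y₂)) ⟩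
      ∑ {2n} (λ z → 1ℚ)                            ≡⟨ ∑-const 2n 1ℚ ⟩
      κ * (1ℚ * 1ℚ)                                ≡⟨ cong (λ p → κ * (p * 1ℚ)) (sym (I-diagonal x₁≡y₁)) ⟩
      κ * (I 2n x₁ y₁ * 1ℚ)                        ∎
    columnSum (no x₁≢y₁) = begin
      ∑ (λ z → W (pos x₁ z) (pos y₁ y₂))
        ≡⟨ sum-cong-≗ (λ z → sym (ℚ.*-identityˡ (W (pos x₁ z) (pos y₁ y₂)))) ⟩
      ∑ (λ z → 1ℚ * W (pos x₁ z) (pos y₁ y₂))   ≡⟨ off x₁ y₁ x₁≢y₁ y₂ y₂ ⟩
      0ℚ                                                ≡⟨ ℚ.*-zeroʳ κ ⟨
      κ * 0ℚ
        ≡⟨ cong (λ p → κ * (p * 1ℚ)) (sym (I-offDiagonal x₁≢y₁)) ⟩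
      κ * (I 2n x₁ y₁ * 1ℚ)                             ∎

  E⊛H : ∀ i → E ⊛ H i ≈ κ • E
  E⊛H i = E⊛bush (H i) (diagonal (bush i)) λ a b a≢b → proj₂ (offDiagonal (bush i) a b a≢b)

  -- Column sums of the transpose are row sums of `H i`, which is the other half of the off-diagonal
  -- Bush condition.
  E⊛Hᵗ : ∀ i → E ⊛ H i ᵗ ≈ κ • E
  E⊛Hᵗ i = E⊛bush (H i ᵗ) (λ a x y → diagonal (bush i) a y x) λ a b a≢b x y →
    trans (sum-cong-≗ λ z → ℚ.*-comm 1ℚ (H i (pos b y) (pos a z)))
      (proj₁ (offDiagonal (bush i) b a (a≢b ∘ sym)) y x)

  -- The orthogonal matrices I, H₁/2n, …, Hₘ/2n and the blocks of their Gram matrix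

  g : Vector (SqMatrix (order n)) (suc m)
  g = I (order n) ∷ λ i → q • H i

  E⊛g : ∀ a → E ⊛ g a ≈ E
  E⊛g zero    = ⊛-identityʳ E
  E⊛g (suc i) x y = trans (⊛-•ʳ q E (H i) x y) (trans (cong (q *_) (E⊛H i x y)) (q*[κ*p]≡p (E x y)))

  E⊛gᵗ : ∀ a → E ⊛ g a ᵗ ≈ E
  E⊛gᵗ zero        = ≈-trans (⊛-cong {A = E} ≈-refl (I-sym (order n))) (⊛-identityʳ E)
  E⊛gᵗ (suc i) x y = trans (⊛-•ʳ q E (H i ᵗ) x y) (trans (cong (q *_) (E⊛Hᵗ i x y)) (q*[κ*p]≡p (E x y)))

  -- Since D E = 2n D, the case of `E` settles both matrices: 2n D A = D E A = D E = 2n D.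
  D-absorbs : ∀ {A} → E ⊛ A ≈ E → ∀ d → D d ⊛ A ≈ D d
  D-absorbs {A} EA≈E d i j = κ-cancel (begin
    κ * (D d ⊛ A) i j        ≡⟨ ⊛-•ˡ κ (D d) A i j ⟨
    ((κ • D d) ⊛ A) i j      ≡⟨ ⊛-cong {B = A} (≈-sym (D⊛E d)) ≈-refl i j ⟩
    ((D d ⊛ E) ⊛ A) i j      ≡⟨ ⊛-assoc (D d) E A i j ⟩
    (D d ⊛ (E ⊛ A)) i j      ≡⟨ ⊛-cong {A = D d} ≈-refl EA≈E i j ⟩
    (D d ⊛ E) i j            ≡⟨ D⊛E d i j ⟩
    κ * D d i j              ∎)

  G : Fin (suc m) → Fin (suc m) → SqMatrix (order n)
  G a b = g a ⊛ g b ᵗ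

  G-sym : ∀ a b → G a b ᵗ ≈ G b a
  G-sym a b = ⊛-ᵗ (g a) (g b ᵗ)

  D⊛G : ∀ d a b → D d ⊛ G a b ≈ D d
  D⊛G d a b = ≈-trans (≈-sym (⊛-assoc (D d) (g a) (g b ᵗ)))
    (≈-trans (⊛-cong {B = g b ᵗ} (D-absorbs (E⊛g a) d) ≈-refl) (D-absorbs (E⊛gᵗ b) d))

  G⊛D : ∀ a b d → G a b ⊛ D d ≈ D d
  G⊛D a b d i j = begin
    (G a b ⊛ D d) i j          ≡⟨ ⊛-ᵗ (G a b) (D d) j i ⟩
    (D d ᵗ ⊛ G a b ᵗ) j i      ≡⟨ ⊛-cong (D-sym d) (G-sym a b) j i ⟩
    (D d ⊛ G b a) j i          ≡⟨ D⊛G d b a j i ⟩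
    D d j i                    ≡⟨ D-sym d i j ⟩
    D d i j                    ∎

  H⊛Hᵗ : ∀ i → H i ⊛ H i ᵗ ≈ (κ * κ) • I (order n)
  H⊛Hᵗ i x y with x ≟ y
  ... | no  x≢y = trans (orthogonal (hadamard (bush i)) x y x≢y) (sym (ℚ.*-zeroʳ (κ * κ)))
  ... | yes refl = begin
    ∑ (λ l → H i x l * H i x l)    ≡⟨ sum-cong-≗ (λ l → ±1-square (entries (hadamard (bush i)) x l)) ⟩
    -- Summing over the two coordinates separately yields the factor `κ * κ` directly.
    ∑ {order n} (λ _ → 1ℚ)         ≡⟨ ∑-combine 2n {2n} (λ _ → 1ℚ) ⟩
    ∑ {2n} (λ _ → ∑ {2n} λ _ → 1ℚ) ≡⟨ ∑-const 2n (∑ {2n} λ _ → 1ℚ) ⟩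
    κ * ∑ {2n} (λ _ → 1ℚ)          ≡⟨ cong (κ *_) (∑-const 2n 1ℚ) ⟩
    κ * (κ * 1ℚ)                   ≡⟨ ℚ.*-assoc κ κ 1ℚ ⟨
    κ * κ * 1ℚ                     ∎

  G-diagonal : ∀ a → G a a ≈ I (order n)
  G-diagonal zero = ≈-trans (⊛-identityˡ (I (order n) ᵗ)) (I-sym (order n))
  G-diagonal (suc i) x y = begin
    ((q • H i) ⊛ (q • H i ᵗ)) x y         ≡⟨ ⊛-•ˡ q (H i) (q • H i ᵗ) x y ⟩
    q * (H i ⊛ (q • H i ᵗ)) x y           ≡⟨ cong (q *_) (⊛-•ʳ q (H i) (H i ᵗ) x y) ⟩
    q * (q * (H i ⊛ H i ᵗ) x y)           ≡⟨ cong (λ p → q * (q * p)) (H⊛Hᵗ i x y) ⟩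
    q * (q * (κ * κ * I (order n) x y))   ≡⟨ cong (λ p → q * (q * p)) (ℚ.*-assoc κ κ (I (order n) x y)) ⟩
    q * (q * (κ * (κ * I (order n) x y))) ≡⟨ cong (q *_) (q*[κ*p]≡p (κ * I (order n) x y)) ⟩
    q * (κ * I (order n) x y)             ≡⟨ q*[κ*p]≡p (I (order n) x y) ⟩
    I (order n) x y                       ∎

  -- The inner factor `g b ᵗ ⊛ g b` concerns columns, while a Hadamard matrix is given by orthogonal
  -- rows; `orthogonal-ᵗ` supplies the passage.
  G⊛G : ∀ a b c → G a b ⊛ G b c ≈ G a c
  G⊛G a b c = R.begin
    (g a ⊛ g b ᵗ) ⊛ (g b ⊛ g c ᵗ)   R.≈⟨ ⊛-assoc (g a) (g b ᵗ) (g b ⊛ g c ᵗ) ⟩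
    g a ⊛ (g b ᵗ ⊛ (g b ⊛ g c ᵗ))   R.≈⟨ ⊛-cong {A = g a} ≈-refl (⊛-assoc (g b ᵗ) (g b) (g c ᵗ)) ⟨
    g a ⊛ ((g b ᵗ ⊛ g b) ⊛ g c ᵗ)
      R.≈⟨ ⊛-cong {A = g a} ≈-refl (⊛-cong {B = g c ᵗ} (orthogonal-ᵗ (g b) (G-diagonal b)) ≈-refl) ⟩
    g a ⊛ (I (order n) ⊛ g c ᵗ)     R.≈⟨ ⊛-cong {A = g a} ≈-refl (⊛-identityˡ (g c ᵗ)) ⟩
    g a ⊛ g c ᵗ                     R.∎
    where module R = SetoidReasoning (≈-setoid (order n) (order n))

  -- The matrix 2n G is the transpose of some H, some H itself, or the Hadamard matrix L provided by
  -- unbiasedness.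
  G-offDiagonal : ∀ {a b} → a ≢ b → ∀ x y → κ * G a b x y ≡ - 1ℚ ⊎ κ * G a b x y ≡ 1ℚ
  G-offDiagonal {zero}  {zero}  a≢b = contradiction refl a≢b
  G-offDiagonal {zero}  {suc j} a≢b x y = subst (λ p → p ≡ - 1ℚ ⊎ p ≡ 1ℚ)
    (sym (trans (cong (κ *_) (⊛-identityˡ (q • H j ᵗ) x y)) (κ*[q*p]≡p (H j y x))))
    (entries (hadamard (bush j)) y x)
  G-offDiagonal {suc i} {zero}  a≢b x y = subst (λ p → p ≡ - 1ℚ ⊎ p ≡ 1ℚ)
    (sym (trans (cong (κ *_) (trans (⊛-cong {A = q • H i} ≈-refl (I-sym (order n)) x y) (⊛-identityʳ (q • H i) x y))) (κ*[q*p]≡p (H i x y))))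
    (entries (hadamard (bush i)) x y)
  G-offDiagonal {suc i} {suc j} a≢b x y with unbiased i j (a≢b ∘ cong suc)
  ... | s , s*s≡ , L , L-hadamard , HHᵗ≈sL = subst (λ p → p ≡ - 1ℚ ⊎ p ≡ 1ℚ) (sym κG≡L) (entries L-hadamard x y)
    where
    κG≡L : κ * G (suc i) (suc j) x y ≡ L x y
    κG≡L = begin
      κ * ((q • H i) ⊛ (q • H j ᵗ)) x y      ≡⟨ cong (κ *_) (⊛-•ˡ q (H i) (q • H j ᵗ) x y) ⟩
      κ * (q * (H i ⊛ (q • H j ᵗ)) x y)      ≡⟨ κ*[q*p]≡p ((H i ⊛ (q • H j ᵗ)) x y) ⟩
      (H i ⊛ (q • H j ᵗ)) x y                ≡⟨ ⊛-•ʳ q (H i) (H j ᵗ) x y ⟩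
      q * (H i ⊛ H j ᵗ) x y                  ≡⟨ cong (q *_) (HHᵗ≈sL x y) ⟩
      q * ((+ s) / 1 * L x y)
        -- The root `s` satisfies s² = (2n)², so it is 2n and cancels against `q`.
        ≡⟨ cong (λ s → q * ((+ s) / 1 * L x y)) (m*m≡n*n⇒m≡n {s} {2n} s*s≡) ⟩
      q * (κ * L x y)                        ≡⟨ q*[κ*p]≡p (L x y) ⟩
      L x y                                  ∎

  -- Multiplication table of the generators

  data Generator : Set where
    one  : Generator
    kron : Fin 2 → Fin 2 → Generator
    gram : Generator

  Γ : Generator → SqMatrix N
  Γ one        = I N
  Γ (kron p d) = IJ (suc m) p ⊗ D d
  Γ gram       = blocks G

  -- `D d` absorbs every block `G c b`, so next to it the Gram matrix acts on the outer factor as J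
  -- does.
  kron⊛gram : ∀ (P : SqMatrix (suc m)) d → (P ⊗ D d) ⊛ blocks G ≈ (P ⊛ J (suc m)) ⊗ D d
  kron⊛gram P d = ≈-trans (blocks-⊛ (λ a b → P a b • D d) G) (blocks-cong λ a b x y → begin
    ∑ (λ c → ((P a c • D d) ⊛ G c b) x y)
      ≡⟨ sum-cong-≗ (λ c → trans (⊛-•ˡ (P a c) (D d) (G c b) x y) (cong (P a c *_) (D⊛G d c b x y))) ⟩
    ∑ (λ c → P a c * D d x y)
      ≡⟨ sum-cong-≗ (λ c → cong (_* D d x y) (sym (ℚ.*-identityʳ (P a c)))) ⟩
    ∑ (λ c → P a c * 1ℚ * D d x y)           ≡⟨ *-distribʳ-sum (D d x y) (λ c → P a c * 1ℚ) ⟨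
    (P ⊛ J (suc m)) a b * D d x y            ∎)

  gram⊛kron : ∀ (P : SqMatrix (suc m)) d → blocks G ⊛ (P ⊗ D d) ≈ (J (suc m) ⊛ P) ⊗ D d
  gram⊛kron P d = ≈-trans (blocks-⊛ G (λ a b → P a b • D d)) (blocks-cong λ a b x y → begin
    ∑ (λ c → (G a c ⊛ (P c b • D d)) x y)
      ≡⟨ sum-cong-≗ (λ c → trans (⊛-•ʳ (P c b) (G a c) (D d) x y) (cong (P c b *_) (G⊛D a c d x y))) ⟩
    ∑ (λ c → P c b * D d x y)
      ≡⟨ sum-cong-≗ (λ c → cong (_* D d x y) (sym (ℚ.*-identityˡ (P c b)))) ⟩
    ∑ (λ c → 1ℚ * P c b * D d x y)           ≡⟨ *-distribʳ-sum (D d x y) (λ c → 1ℚ * P c b) ⟨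
    (J (suc m) ⊛ P) a b * D d x y            ∎)

  gram⊛gram : blocks G ⊛ blocks G ≈ ((+ suc m) / 1) • blocks G
  gram⊛gram = ≈-trans (blocks-⊛ G G) (blocks-cong λ a b x y →
    trans (sum-cong-≗ λ c → G⊛G a c b x y) (∑-const (suc m) (G a b x y)))

  Γ⊛Γ : ∀ x y → ∃[ c ] ∃[ z ] Γ x ⊛ Γ y ≈ c • Γ z
  Γ⊛Γ one        y          = 1ℚ , y , ≈-trans (⊛-identityˡ (Γ y)) (1•-identity (Γ y))
  Γ⊛Γ (kron p d) one        = 1ℚ , kron p d , ≈-trans (⊛-identityʳ (Γ (kron p d))) (1•-identity (Γ (kron p d)))
  Γ⊛Γ gram       one        = 1ℚ , gram , ≈-trans (⊛-identityʳ (Γ gram)) (1•-identity (Γ gram))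
  Γ⊛Γ (kron p d) (kron r e) = kron⊛kron (IJ-⊛ (suc m) p r) (D⊛D d e)
    where
    kron⊛kron : (∃[ c ] ∃[ s ] IJ (suc m) p ⊛ IJ (suc m) r ≈ c • IJ (suc m) s) →
      (∃[ c ] ∃[ f ] D d ⊛ D e ≈ c • D f) → ∃[ c ] ∃[ z ] Γ (kron p d) ⊛ Γ (kron r e) ≈ c • Γ z
    kron⊛kron (c , s , P≈) (c′ , f , D≈) = c * c′ , kron s f ,
      ⊗-⊛-scaled c c′ (IJ (suc m) p) (IJ (suc m) r) (IJ (suc m) s) (D d) (D e) (D f) P≈ D≈
  Γ⊛Γ (kron p d) gram = scaled (IJ-⊛ (suc m) p (suc zero))
    where
    scaled : (∃[ c ] ∃[ s ] IJ (suc m) p ⊛ J (suc m) ≈ c • IJ (suc m) s) →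
      ∃[ c ] ∃[ z ] Γ (kron p d) ⊛ Γ gram ≈ c • Γ z
    scaled (c , s , P≈) = c , kron s d ,
      ≈-trans (kron⊛gram (IJ (suc m) p) d) (⊗-scaledˡ c (IJ (suc m) p ⊛ J (suc m)) (IJ (suc m) s) (D d) P≈)
  Γ⊛Γ gram (kron p d) = scaled (IJ-⊛ (suc m) (suc zero) p)
    where
    scaled : (∃[ c ] ∃[ s ] J (suc m) ⊛ IJ (suc m) p ≈ c • IJ (suc m) s) →
      ∃[ c ] ∃[ z ] Γ gram ⊛ Γ (kron p d) ≈ c • Γ z
    scaled (c , s , P≈) = c , kron s d ,
      ≈-trans (gram⊛kron (IJ (suc m) p) d) (⊗-scaledˡ c (J (suc m) ⊛ IJ (suc m) p) (IJ (suc m) s) (D d) P≈)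
  Γ⊛Γ gram gram = ((+ suc m) / 1) , gram , gram⊛gram

  -- Entries of B

  M≈gram : M H ≈ blocks G
  M≈gram i j = sum-cong-≗ λ l →
    cong (g (quotient (order n) i) (remainder {suc m} (order n) i) l *_)
      (row (quotient (order n) j) l (remainder {suc m} (order n) j))
    where
    row : ∀ b l y → (I (order n) ∷ λ i → q • H i ᵗ) b l y ≡ g b y l
    -- The block row of M carries I where the Gram matrix has its transpose; the other blocks agree
    -- definitionally.
    row zero    l y = I-sym (order n) y l
    row (suc b) l y = refl

  B≈ : B H ≈ κ • (blocks G ⊖ I N)
  B≈ i j = cong (λ p → κ * (p - I N i j)) (M≈gram i j)

  B-sym : IsSymmetric (B H)
  B-sym i j = begin
    B H j i                        ≡⟨ B≈ j i ⟩
    κ * (blocks G j i - I N j i)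
      ≡⟨ cong₂ (λ p r → κ * (p - r)) (G-sym (quotient (order n) j) (quotient (order n) i)
        (remainder {suc m} (order n) i) (remainder {suc m} (order n) j)) (I-sym N i j) ⟩
    κ * (blocks G i j - I N i j)   ≡⟨ B≈ i j ⟨
    B H i j                        ∎

  -- The subtracted term is block (a, b) of the identity of order N, as seen through `I⊗I`.
  Bᵇ : Fin (suc m) → Fin (suc m) → SqMatrix (order n)
  Bᵇ a b = κ • (G a b ⊖ I (suc m) a b • I (order n))

  B≈blocks : B H ≈ blocks Bᵇ
  B≈blocks i j = trans (B≈ i j) (cong (λ p → κ * (blocks G i j - p)) (sym (I⊗I (suc m) (order n) i j)))

  Bᵇ-diagonal : ∀ a x y → Bᵇ a a x y ≡ 0ℚ
  Bᵇ-diagonal a x y = trans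
    (cong₂ (λ p r → κ * (p - r * I (order n) x y)) (G-diagonal a x y) (I-diagonal {i = a} refl))
    (solve 2 (λ κ x → κ :* (x :- con 1ℚ :* x) := con 0ℚ) refl κ (I (order n) x y))

  Bᵇ-offDiagonal : ∀ {a b} → a ≢ b → ∀ x y → Bᵇ a b x y ≡ κ * G a b x y
  Bᵇ-offDiagonal {a} {b} a≢b x y = trans
    (cong (λ r → κ * (G a b x y - r * I (order n) x y)) (I-offDiagonal a≢b))
    (solve 3 (λ κ x y → κ :* (x :- con 0ℚ :* y) := κ :* x) refl κ (G a b x y) (I (order n) x y))

  Bᵇ-±1 : ∀ {a b} → a ≢ b → ∀ x y → Bᵇ a b x y ≡ - 1ℚ ⊎ Bᵇ a b x y ≡ 1ℚ
  Bᵇ-±1 {a} {b} a≢b x y = subst (λ p → p ≡ - 1ℚ ⊎ p ≡ 1ℚ) (sym (Bᵇ-offDiagonal a≢b x y)) (G-offDiagonal a≢b x y)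

  Bᵇ-0±1 : ∀ a b x y → Bᵇ a b x y ≡ 0ℚ ⊎ Bᵇ a b x y ≡ 1ℚ ⊎ Bᵇ a b x y ≡ - 1ℚ
  Bᵇ-0±1 a b x y = go (a ≟ b)
    where
    go : Dec (a ≡ b) → Bᵇ a b x y ≡ 0ℚ ⊎ Bᵇ a b x y ≡ 1ℚ ⊎ Bᵇ a b x y ≡ - 1ℚ
    go (yes refl) = inj₁ (Bᵇ-diagonal a x y)
    go (no a≢b)   = inj₂ (swap (Bᵇ-±1 a≢b x y))

  -- Squaring entries removes the signs and leaves the support of B, which `sum≡square` turns into
  -- the sum of the two parts of a splitting.
  Bᵇ² : ∀ a b x y → Bᵇ a b x y * Bᵇ a b x y ≡ 1ℚ - I (suc m) a b
  Bᵇ² a b x y = go (a ≟ b)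
    where
    go : Dec (a ≡ b) → Bᵇ a b x y * Bᵇ a b x y ≡ 1ℚ - I (suc m) a b
    go (yes refl) = trans (cong (λ p → p * p) (Bᵇ-diagonal a x y)) (cong (λ p → 1ℚ - p) (sym (I-diagonal {i = a} refl)))
    go (no a≢b)   = trans (±1-square (Bᵇ-±1 a≢b x y)) (cong (λ p → 1ℚ - p) (sym (I-offDiagonal a≢b)))

  -- `D (suc zero)` is the all-ones matrix, so any row of `D (suc zero) ⊛ E` lists the column sums
  -- of `E`.
  ∑E : ∀ y → ∑ (λ l → E l y) ≡ κ
  ∑E y = trans (sum-cong-≗ λ l → sym (ℚ.*-identityˡ (E l y))) (trans (D⊛E (suc zero) y y) (ℚ.*-identityʳ κ))

  E-cases : ∀ x y → E x y ≡ 0ℚ ⊎ E x y ≡ 1ℚ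
  E-cases x y = zeroOne-* (I-zeroOne 2n (quotient {2n} 2n x) (quotient {2n} 2n y)) (inj₂ refl)

  -- In a row x of an off-diagonal block of B, the entries in a column block
  -- have the sum 2n · E x y; when this is 2n they must all equal 1.
  Bᵇ-E : ∀ {a b} → a ≢ b → ∀ x y → E x y ≡ 1ℚ → Bᵇ a b x y ≡ 1ℚ
  Bᵇ-E {a} {b} a≢b x y Exy≡1 = begin
    Bᵇ a b x y
      ≡⟨ solve 1 (λ p → p := con 1ℚ :- (con 1ℚ :- p) :* con 1ℚ) refl (Bᵇ a b x y) ⟩
    1ℚ - (1ℚ - Bᵇ a b x y) * 1ℚ
      -- The inserted factor 1 becomes `E y y`, which makes the deviation from 1 the summand at `y`
      -- of a vanishing sum of nonnegative terms.
      ≡⟨ cong (λ e → 1ℚ - (1ℚ - Bᵇ a b x y) * e) (sym (cong (_* 1ℚ) (I-diagonal {i = quotient {2n} 2n y} refl))) ⟩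
    1ℚ - (1ℚ - Bᵇ a b x y) * E y y     ≡⟨ cong (λ p → 1ℚ - p) (∑-nonNeg-zero nonNeg ∑≡0 y) ⟩
    1ℚ                                 ∎
    where
    nonNeg : ∀ l → 0ℚ ≤ℚ (1ℚ - Bᵇ a b x l) * E l y
    nonNeg l = 0≤[1-±1]*[0,1] (Bᵇ-±1 a≢b x l) (E-cases l y)

    ∑≡0 : ∑ (λ l → (1ℚ - Bᵇ a b x l) * E l y) ≡ 0ℚ
    ∑≡0 = begin
      ∑ (λ l → (1ℚ - Bᵇ a b x l) * E l y)
        ≡⟨ sum-cong-≗ (λ l → trans (cong (λ p → (1ℚ - p) * E l y) (Bᵇ-offDiagonal a≢b x l))
             (solve 3 (λ κ p e → (con 1ℚ :- κ :* p) :* e := con 1ℚ :* e :+ (:- κ) :* (p :* e)) refl κ (G a b x l) (E l y))) ⟩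
      ∑ (λ l → 1ℚ * E l y + (- κ) * (G a b x l * E l y))
        ≡⟨ ∑-linear 1ℚ (- κ) (λ l → E l y) (λ l → G a b x l * E l y) ⟩
      1ℚ * ∑ (λ l → E l y) + (- κ) * (G a b ⊛ E) x y
        ≡⟨ cong₂ (λ p r → 1ℚ * p + (- κ) * r) (∑E y) (trans (G⊛D a b zero x y) Exy≡1) ⟩
      1ℚ * κ + (- κ) * 1ℚ
        ≡⟨ solve 1 (λ κ → con 1ℚ :* κ :+ (:- κ) :* con 1ℚ := con 0ℚ) refl κ ⟩
      0ℚ ∎

  -- Comparing B E = 2n E with (p E + c J) E in a column y where E vanishes.
  Bᵇ-row-affine : ∀ {a b} → a ≢ b → ∀ x y p c → E x y ≡ 0ℚ → (∀ l → Bᵇ a b x l ≡ p * E x l + c) → c ≡ 0ℚ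
  Bᵇ-row-affine {a} {b} a≢b x y p c Exy≡0 affine = κ-cancel (begin
    κ * c
      ≡⟨ solve 3 (λ κ p c → κ :* c := p :* (κ :* con 0ℚ) :+ c :* κ) refl κ p c ⟩
    p * (κ * 0ℚ) + c * κ
      ≡⟨ cong₂ (λ r s → p * (κ * r) + c * s) (sym Exy≡0) (sym (∑E y)) ⟩
    p * (κ * E x y) + c * ∑ (λ l → E l y)
      ≡⟨ cong (λ r → p * r + c * ∑ (λ l → E l y)) (sym (D⊛E zero x y)) ⟩
    p * (E ⊛ E) x y + c * ∑ (λ l → E l y)              ≡⟨ ∑-linear p c (λ l → E x l * E l y) (λ l → E l y) ⟨
    ∑ (λ l → p * (E x l * E l y) + c * E l y)
      ≡⟨ sum-cong-≗ (λ l → trans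
        (solve 4 (λ p c e f → p :* (e :* f) :+ c :* f := (p :* e :+ c) :* f) refl p c (E x l) (E l y))
        (cong (_* E l y) (trans (sym (affine l)) (Bᵇ-offDiagonal a≢b x l)))) ⟩
    ((κ • G a b) ⊛ E) x y                              ≡⟨ ⊛-•ˡ κ (G a b) E x y ⟩
    κ * (G a b ⊛ E) x y                                ≡⟨ cong (κ *_) (trans (G⊛D a b zero x y) Exy≡0) ⟩
    κ * 0ℚ                                             ∎)

  B-0±1 : IsZeroOneMinusOne (B H)
  B-0±1 i j = subst (λ p → p ≡ 0ℚ ⊎ p ≡ 1ℚ ⊎ p ≡ - 1ℚ) (sym (B≈blocks i j))
    (Bᵇ-0±1 (quotient (order n) i) (quotient (order n) j) (remainder {suc m} (order n) i) (remainder {suc m} (order n) j))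

  splitting : IsSplitting (B H) (λ i j → ½ * (B H i j * B H i j + B H i j)) (λ i j → ½ * (B H i j * B H i j - B H i j))
  splitting = record
    { zeroOne₁   = λ i j → proj₁ (halves (B-0±1 i j))
    ; zeroOne₂   = λ i j → proj₁ (proj₂ (halves (B-0±1 i j)))
    ; disjoint   = λ i j → proj₂ (proj₂ (halves (B-0±1 i j)))
    ; difference = λ i j → solve 1 (λ p → p := con ½ :* (p :* p :+ p) :- con ½ :* (p :* p :- p)) refl (B H i j)
    }

  -- The six classes of a given splitting

  module _ (B₁ B₂ : SqMatrix N) (split : IsSplitting (B H) B₁ B₂) {a₁ : Fin (suc m)} (0≢a₁ : zero ≢ a₁) where

    open IsSplitting split

    -- The support of B, and therefore A₃ + A₄ + A₅.
    S : SqMatrix N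
    S = (J (suc m) ⊖ I (suc m)) ⊗ D (suc zero)

    B₁+B₂≡B² : ∀ i j → B₁ i j + B₂ i j ≡ B H i j * B H i j
    B₁+B₂≡B² i j = sum≡square (zeroOne₁ i j) (zeroOne₂ i j) (disjoint i j) (difference i j)

    B₁+B₂≡S : ∀ i j → B₁ i j + B₂ i j ≡ S i j
    B₁+B₂≡S i j = trans (B₁+B₂≡B² i j) (trans (cong (λ p → p * p) (B≈blocks i j)) (trans
      (Bᵇ² (quotient (order n) i) (quotient (order n) j) (remainder {suc m} (order n) i) (remainder {suc m} (order n) j))
      (sym (ℚ.*-identityʳ (1ℚ - I (suc m) (quotient (order n) i) (quotient (order n) j))))))

    -- Half the sum of B₁ + B₂ = S and B₁ - B₂ = B. Symmetry and span membership of `A₄` are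
    -- inherited from S and B through this formula.
    B₁≡ : ∀ i j → B₁ i j ≡ ½ * S i j + ½ * B H i j
    B₁≡ i j = trans (solve 2 (λ x y → x := con ½ :* (x :+ y) :+ con ½ :* (x :- y)) refl (B₁ i j) (B₂ i j))
      (cong₂ (λ p r → ½ * p + ½ * r) (B₁+B₂≡S i j) (sym (difference i j)))

    B₂≡ : ∀ i j → B₂ i j ≡ ½ * S i j + (- ½) * B H i j
    B₂≡ i j = trans (solve 2 (λ x y → y := con ½ :* (x :+ y) :+ con (- ½) :* (x :- y)) refl (B₁ i j) (B₂ i j))
      (cong₂ (λ p r → ½ * p + (- ½) * r) (B₁+B₂≡S i j) (sym (difference i j)))

    C : Vector (SqMatrix N) 6
    C = classes B₁ B₂

    A₃′ : SqMatrix N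
    A₃′ = A₃ B₁ B₂

    -- Entries of the three nested Kronecker factors. Entries of I, `A₁`, `A₂` and `A₃` are
    -- polynomials in α, β, γ, so identities between these matrices become ring identities.
    module Entry (i j : Fin N) where
      a b : Fin (suc m)
      a = quotient (order n) i
      b = quotient (order n) j

      x y : Fin (order n)
      x = remainder {suc m} (order n) i
      y = remainder {suc m} (order n) j

      α β γ : ℚ
      α = I (suc m) a b
      β = I 2n (quotient {2n} 2n x) (quotient {2n} 2n y)
      γ = I 2n (remainder {2n} 2n x) (remainder {2n} 2n y)

      I≡αβγ : I N i j ≡ α * (β * γ)
      I≡αβγ = trans (sym (I⊗I (suc m) (order n) i j)) (cong (α *_) (sym (I⊗I 2n 2n x y)))

      α-cases : α ≡ 0ℚ ⊎ α ≡ 1ℚ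
      α-cases = I-zeroOne (suc m) a b

      β-cases : β ≡ 0ℚ ⊎ β ≡ 1ℚ
      β-cases = I-zeroOne 2n (quotient {2n} 2n x) (quotient {2n} 2n y)

      γ-cases : γ ≡ 0ℚ ⊎ γ ≡ 1ℚ
      γ-cases = I-zeroOne 2n (remainder {2n} 2n x) (remainder {2n} 2n y)

    S-sym : IsSymmetric S
    S-sym = ⊗-sym {A = J (suc m) ⊖ I (suc m)} {B = D (suc zero)} (λ a b → cong (λ p → 1ℚ - p) (I-sym (suc m) a b)) (D-sym (suc zero))

    A₃-sym : IsSymmetric A₃′
    A₃-sym = ⊗-sym {A = J (suc m) ⊖ I (suc m)} {B = E} (λ a b → cong (λ p → 1ℚ - p) (I-sym (suc m) a b)) (D-sym zero)

    C-sym : ∀ i → IsSymmetric (C i)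
    C-sym zero                               = I-sym N
    C-sym (suc zero)                         = ⊗-sym {A = I (suc m)} {B = I 2n ⊗ (J 2n ⊖ I 2n)} (I-sym (suc m))
      (⊗-sym {A = I 2n} {B = J 2n ⊖ I 2n} (I-sym 2n) λ a b → cong (λ p → 1ℚ - p) (I-sym 2n a b))
    C-sym (suc (suc zero))                   = ⊗-sym {A = I (suc m)} {B = (J 2n ⊖ I 2n) ⊗ J 2n} (I-sym (suc m))
      (⊗-sym {A = J 2n ⊖ I 2n} {B = J 2n} (λ a b → cong (λ p → 1ℚ - p) (I-sym 2n a b)) λ a b → refl)
    C-sym (suc (suc (suc zero)))             = A₃-sym
    C-sym (suc (suc (suc (suc zero)))) i j = cong₂ _-_
      (trans (B₁≡ j i) (trans (cong₂ (λ p r → ½ * p + ½ * r) (S-sym i j) (B-sym i j)) (sym (B₁≡ i j))))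
      (A₃-sym i j)
    C-sym (suc (suc (suc (suc (suc zero))))) i j =
      trans (B₂≡ j i) (trans (cong₂ (λ p r → ½ * p + (- ½) * r) (S-sym i j) (B-sym i j)) (sym (B₂≡ i j)))

    C-zeroOne : ∀ i → IsZeroOne (C i)
    C-zeroOne zero = I-zeroOne N
    C-zeroOne (suc zero) i j = zeroOne-* α-cases (zeroOne-* β-cases (zeroOne-1- γ-cases))
      where open Entry i j
    C-zeroOne (suc (suc zero)) i j = zeroOne-* α-cases (zeroOne-* (zeroOne-1- β-cases) (inj₂ refl))
      where open Entry i j
    C-zeroOne (suc (suc (suc zero))) i j = zeroOne-* (zeroOne-1- α-cases) (zeroOne-* β-cases (inj₂ refl))
      where open Entry i j
    C-zeroOne (suc (suc (suc (suc zero)))) i j = go (a ≟ b) (E-cases x y)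
      where
      open Entry i j
      ZeroOne = λ p → p ≡ 0ℚ ⊎ p ≡ 1ℚ

      go : Dec (a ≡ b) → E x y ≡ 0ℚ ⊎ E x y ≡ 1ℚ → ZeroOne (B₁ i j - (1ℚ - α) * E x y)
      go (yes a≡b) _ = subst ZeroOne (sym (trans (cong (λ α → B₁ i j - (1ℚ - α) * E x y) (I-diagonal a≡b))
        (solve 2 (λ u e → u :- (con 1ℚ :- con 1ℚ) :* e := u) refl (B₁ i j) (E x y)))) (zeroOne₁ i j)
      go (no a≢b) (inj₁ E≡0) = subst ZeroOne (sym (trans (cong (λ e → B₁ i j - (1ℚ - α) * e) E≡0)
        (solve 2 (λ u v → u :- v :* con 0ℚ := u) refl (B₁ i j) (1ℚ - α)))) (zeroOne₁ i j)
      -- The only case in which `A₃` is 1. By `Bᵇ-E` the entry of B is then 1, so B₁ is 1 as well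
      -- and the difference is 0.
      go (no a≢b) (inj₂ E≡1) = inj₁ (begin
        B₁ i j - (1ℚ - α) * E x y                            ≡⟨ cong (λ u → u - (1ℚ - α) * E x y) (B₁≡ i j) ⟩
        ½ * S i j + ½ * B H i j - (1ℚ - α) * E x y
          ≡⟨ cong (λ u → ½ * S i j + ½ * u - (1ℚ - α) * E x y) (trans (B≈blocks i j) (Bᵇ-E a≢b x y E≡1)) ⟩
        ½ * ((1ℚ - α) * 1ℚ) + ½ * 1ℚ - (1ℚ - α) * E x y
          ≡⟨ cong₂ (λ α e → ½ * ((1ℚ - α) * 1ℚ) + ½ * 1ℚ - (1ℚ - α) * e) (I-offDiagonal a≢b) E≡1 ⟩
        0ℚ                                                   ∎)
    C-zeroOne (suc (suc (suc (suc (suc zero))))) = zeroOne₂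

    C-partition : ∑ᴹ C ≈ J N
    C-partition i j = begin
      ∑ᴹ C i j
        ≡⟨ cong (λ p → p + (α * (β * (1ℚ - γ)) + (α * ((1ℚ - β) * 1ℚ) + (A₃′ i j + ((B₁ i j - A₃′ i j) + (B₂ i j + 0ℚ)))))) I≡αβγ ⟩
      α * (β * γ) + (α * (β * (1ℚ - γ)) + (α * ((1ℚ - β) * 1ℚ) + (A₃′ i j + ((B₁ i j - A₃′ i j) + (B₂ i j + 0ℚ)))))
        ≡⟨ solve 6 (λ α β γ t u v → α :* (β :* γ) :+ (α :* (β :* (con 1ℚ :- γ)) :+ (α :* ((con 1ℚ :- β) :* con 1ℚ) :+
               (t :+ ((u :- t) :+ (v :+ con 0ℚ))))) := α :+ (u :+ v))
             refl α β γ (A₃′ i j) (B₁ i j) (B₂ i j) ⟩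
      α + (B₁ i j + B₂ i j)
        ≡⟨ cong (λ p → α + p) (B₁+B₂≡S i j) ⟩
      α + (1ℚ - α) * 1ℚ
        ≡⟨ solve 1 (λ α → α :+ (con 1ℚ :- α) :* con 1ℚ := con 1ℚ) refl α ⟩
      1ℚ ∎
      where open Entry i j

    -- Equality of the two spans and closure under products

    S∈ΓSpan : Span Γ S
    S∈ΓSpan = combination 1ℚ (- 1ℚ) (generator (kron (suc zero) (suc zero))) (generator (kron zero (suc zero))) λ i j →
      let open Entry i j in
      solve 1 (λ α → (con 1ℚ :- α) :* con 1ℚ := con 1ℚ :* con 1ℚ :+ con (- 1ℚ) :* (α :* con 1ℚ)) refl α

    B∈ΓSpan : Span Γ (B H)
    B∈ΓSpan = combination κ (- κ) (generator gram) (generator one) λ i j → trans (B≈ i j)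
      (solve 3 (λ κ u v → κ :* (u :- v) := κ :* u :+ (:- κ) :* v) refl κ (blocks G i j) (I N i j))

    C∈ΓSpan : ∀ i → Span Γ (C i)
    C∈ΓSpan zero = generator one
    C∈ΓSpan (suc zero) = combination 1ℚ (- 1ℚ) (generator (kron zero zero)) (generator one) λ i j →
      let open Entry i j in
      trans (solve 3 (λ α β γ → α :* (β :* (con 1ℚ :- γ)) := con 1ℚ :* (α :* (β :* con 1ℚ)) :+ con (- 1ℚ) :* (α :* (β :* γ))) refl α β γ)
        (cong (λ p → 1ℚ * (α * (β * 1ℚ)) + (- 1ℚ) * p) (sym I≡αβγ))
    C∈ΓSpan (suc (suc zero)) = combination 1ℚ (- 1ℚ) (generator (kron zero (suc zero))) (generator (kron zero zero)) λ i j →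
      let open Entry i j in
      solve 2 (λ α β → α :* ((con 1ℚ :- β) :* con 1ℚ) := con 1ℚ :* (α :* con 1ℚ) :+ con (- 1ℚ) :* (α :* (β :* con 1ℚ))) refl α β
    C∈ΓSpan (suc (suc (suc zero))) = combination 1ℚ (- 1ℚ) (generator (kron (suc zero) zero)) (generator (kron zero zero)) λ i j →
      let open Entry i j in
      solve 2 (λ α e → (con 1ℚ :- α) :* e := con 1ℚ :* (con 1ℚ :* e) :+ con (- 1ℚ) :* (α :* e)) refl α (E x y)
    C∈ΓSpan (suc (suc (suc (suc zero)))) = combination 1ℚ (- 1ℚ)
      (combination ½ ½ S∈ΓSpan B∈ΓSpan B₁≡) (C∈ΓSpan (suc (suc (suc zero)))) λ i j →
      solve 2 (λ u v → u :- v := con 1ℚ :* u :+ con (- 1ℚ) :* v) refl (B₁ i j) (A₃′ i j)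
    C∈ΓSpan (suc (suc (suc (suc (suc zero))))) = combination ½ (- ½) S∈ΓSpan B∈ΓSpan B₂≡

    B₁∈CSpan : Span C B₁
    B₁∈CSpan = combination 1ℚ 1ℚ (generator (suc (suc (suc zero)))) (generator (suc (suc (suc (suc zero))))) λ i j →
      solve 2 (λ u t → u := con 1ℚ :* t :+ con 1ℚ :* (u :- t)) refl (B₁ i j) (A₃′ i j)

    S∈CSpan : Span C S
    S∈CSpan = combination 1ℚ 1ℚ B₁∈CSpan (generator (suc (suc (suc (suc (suc zero)))))) λ i j →
      trans (sym (B₁+B₂≡S i j)) (solve 2 (λ u v → u :+ v := con 1ℚ :* u :+ con 1ℚ :* v) refl (B₁ i j) (B₂ i j))

    B∈CSpan : Span C (B H)
    B∈CSpan = combination 1ℚ (- 1ℚ) B₁∈CSpan (generator (suc (suc (suc (suc (suc zero)))))) λ i j →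
      trans (difference i j) (solve 2 (λ u v → u :- v := con 1ℚ :* u :+ con (- 1ℚ) :* v) refl (B₁ i j) (B₂ i j))

    I⊗E∈CSpan : Span C (Γ (kron zero zero))
    I⊗E∈CSpan = combination 1ℚ 1ℚ (generator zero) (generator (suc zero)) λ i j →
      let open Entry i j in
      trans (solve 3 (λ α β γ → α :* (β :* con 1ℚ) := con 1ℚ :* (α :* (β :* γ)) :+ con 1ℚ :* (α :* (β :* (con 1ℚ :- γ)))) refl α β γ)
        (cong (λ p → 1ℚ * p + 1ℚ * (α * (β * (1ℚ - γ)))) (sym I≡αβγ))

    I⊗U∈CSpan : Span C (Γ (kron zero (suc zero)))
    I⊗U∈CSpan = combination 1ℚ 1ℚ I⊗E∈CSpan (generator (suc (suc zero))) λ i j →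
      let open Entry i j in
      solve 2 (λ α β → α :* con 1ℚ := con 1ℚ :* (α :* (β :* con 1ℚ)) :+ con 1ℚ :* (α :* ((con 1ℚ :- β) :* con 1ℚ))) refl α β

    Γ∈CSpan : ∀ x → Span C (Γ x)
    Γ∈CSpan one = generator zero
    Γ∈CSpan (kron zero zero)       = I⊗E∈CSpan
    Γ∈CSpan (kron zero (suc zero)) = I⊗U∈CSpan
    Γ∈CSpan (kron (suc zero) zero) = combination 1ℚ 1ℚ I⊗E∈CSpan (generator (suc (suc (suc zero)))) λ i j →
      let open Entry i j in
      solve 2 (λ α e → con 1ℚ :* e := con 1ℚ :* (α :* e) :+ con 1ℚ :* ((con 1ℚ :- α) :* e)) refl α (E x y)
    Γ∈CSpan (kron (suc zero) (suc zero)) = combination 1ℚ 1ℚ I⊗U∈CSpan S∈CSpan λ i j →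
      let open Entry i j in
      solve 1 (λ α → con 1ℚ := con 1ℚ :* (α :* con 1ℚ) :+ con 1ℚ :* ((con 1ℚ :- α) :* con 1ℚ)) refl α
    -- The definition of B solved for M: M = I + B/2n.
    Γ∈CSpan gram = combination 1ℚ q (generator zero) B∈CSpan λ i j → begin
      blocks G i j
        ≡⟨ solve 2 (λ u v → u := con 1ℚ :* v :+ (u :- v)) refl (blocks G i j) (I N i j) ⟩
      1ℚ * I N i j + (blocks G i j - I N i j)
        ≡⟨ cong (λ p → 1ℚ * I N i j + p) (sym (q*[κ*p]≡p (blocks G i j - I N i j))) ⟩
      1ℚ * I N i j + q * (κ * (blocks G i j - I N i j))
        ≡⟨ cong (λ p → 1ℚ * I N i j + q * p) (sym (B≈ i j)) ⟩
      1ℚ * I N i j + q * B H i j                               ∎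

    -- Both factors are rewritten in the generators, multiplied there by the monomial table `Γ⊛Γ`,
    -- and the results are carried back to the classes.
    C-product : ∀ i j → Span C (C i ⊛ C j)
    C-product i j = span-⊛ ΓΓ∈CSpan (C∈ΓSpan i) (C∈ΓSpan j)
      where
      ΓΓ∈CSpan : ∀ x y → Span C (Γ x ⊛ Γ y)
      ΓΓ∈CSpan x y = let c , z , ΓΓ≈cΓ = Γ⊛Γ x y in span-resp-≈ (span-• c (Γ∈CSpan z)) ΓΓ≈cΓ

    -- Nonvanishing of the classes

    p₀ p₁ : Fin 2n
    p₀ = proj₁ (distinctPair n)
    p₁ = proj₁ (proj₂ (distinctPair n))

    p₀≢p₁ : p₀ ≢ p₁
    p₀≢p₁ = proj₂ (proj₂ (distinctPair n))

    at : Fin (suc m) → Fin 2n → Fin 2n → Fin N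
    at a u v = combine a (pos u v)

    column : Fin (order n) → Fin N
    column = combine a₁

    at-⊗ : ∀ P Q R a u v b w z → (P ⊗ Q ⊗ R) (at a u v) (at b w z) ≡ P a b * (Q u w * R v z)
    at-⊗ P Q R a u v b w z = trans (⊗-combine P (Q ⊗ R) a b (pos u v) (pos w z))
      (cong (P a b *_) (⊗-combine Q R u w v z))

    R⊗-entry : ∀ X l → ((J (suc m) ⊖ I (suc m)) ⊗ X) (at zero p₀ p₀) (column l) ≡ X (pos p₀ p₀) l
    R⊗-entry X l = trans (⊗-combine (J (suc m) ⊖ I (suc m)) X zero a₁ (pos p₀ p₀) l)
      (trans (cong (λ u → (1ℚ - u) * X (pos p₀ p₀) l) (I-offDiagonal 0≢a₁)) (ℚ.*-identityˡ (X (pos p₀ p₀) l)))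

    E≡0 : E (pos p₀ p₀) (pos p₁ p₀) ≡ 0ℚ
    E≡0 = trans (⊗-combine (I 2n) (J 2n) p₀ p₁ p₀ p₀) (cong (_* 1ℚ) (I-offDiagonal p₀≢p₁))

    C-nonzero : ∀ i → ¬ (C i ≈ O N N)
    C-nonzero zero C≈O = 1≢0 (trans (sym (I-diagonal {i = at zero p₀ p₀} refl)) (C≈O (at zero p₀ p₀) (at zero p₀ p₀)))
    C-nonzero (suc zero) C≈O = 1≢0 (begin
      1ℚ * (1ℚ * (1ℚ - 0ℚ))
        ≡⟨ cong₂ (λ u v → u * (v * (1ℚ - 0ℚ))) (sym (I-diagonal {i = zero {m}} refl)) (sym (I-diagonal {i = p₀} refl)) ⟩
      I (suc m) zero zero * (I 2n p₀ p₀ * (1ℚ - 0ℚ))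
        ≡⟨ cong (λ u → I (suc m) zero zero * (I 2n p₀ p₀ * (1ℚ - u))) (sym (I-offDiagonal p₀≢p₁)) ⟩
      I (suc m) zero zero * (I 2n p₀ p₀ * (J 2n ⊖ I 2n) p₀ p₁)
        ≡⟨ at-⊗ (I (suc m)) (I 2n) (J 2n ⊖ I 2n) zero p₀ p₀ zero p₀ p₁ ⟨
      C (suc zero) (at zero p₀ p₀) (at zero p₀ p₁)
        ≡⟨ C≈O (at zero p₀ p₀) (at zero p₀ p₁) ⟩
      0ℚ                                                                        ∎)
    C-nonzero (suc (suc zero)) C≈O = 1≢0 (begin
      1ℚ * ((1ℚ - 0ℚ) * 1ℚ)
        ≡⟨ cong₂ (λ u v → u * ((1ℚ - v) * 1ℚ)) (sym (I-diagonal {i = zero {m}} refl)) (sym (I-offDiagonal p₀≢p₁)) ⟩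
      I (suc m) zero zero * ((J 2n ⊖ I 2n) p₀ p₁ * 1ℚ)
        ≡⟨ at-⊗ (I (suc m)) (J 2n ⊖ I 2n) (J 2n) zero p₀ p₀ zero p₁ p₀ ⟨
      C (suc (suc zero)) (at zero p₀ p₀) (at zero p₁ p₀)
        ≡⟨ C≈O (at zero p₀ p₀) (at zero p₁ p₀) ⟩
      0ℚ                                                                        ∎)
    C-nonzero (suc (suc (suc zero))) C≈O = 1≢0 (begin
      (1ℚ - 0ℚ) * (1ℚ * 1ℚ)
        ≡⟨ cong₂ (λ u v → (1ℚ - u) * (v * 1ℚ)) (sym (I-offDiagonal 0≢a₁)) (sym (I-diagonal {i = p₀} refl)) ⟩
      (J (suc m) ⊖ I (suc m)) zero a₁ * (I 2n p₀ p₀ * 1ℚ)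
        ≡⟨ at-⊗ (J (suc m) ⊖ I (suc m)) (I 2n) (J 2n) zero p₀ p₀ a₁ p₀ p₀ ⟨
      A₃′ (at zero p₀ p₀) (at a₁ p₀ p₀)
        ≡⟨ C≈O (at zero p₀ p₀) (at a₁ p₀ p₀) ⟩
      0ℚ                                                                        ∎)
    -- If `A₄` were zero, then B₁ = A₃ and B = 2A₃ - S. The chosen row of block (0, a₁) would be 2E
    -- - 1, which gives the constants 2 and -1; column `pos p₁ p₀` is one where this row of `E`
    -- vanishes.
    C-nonzero (suc (suc (suc (suc zero)))) C≈O = -1≢0 (Bᵇ-row-affine 0≢a₁ (pos p₀ p₀) (pos p₁ p₀) (1ℚ + 1ℚ) (- 1ℚ) E≡0 λ l →
      let i = at zero p₀ p₀ ; j = column l in begin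
      Bᵇ zero a₁ (pos p₀ p₀) l                                 ≡⟨ blocks-combine Bᵇ zero a₁ (pos p₀ p₀) l ⟨
      blocks Bᵇ i j                                            ≡⟨ B≈blocks i j ⟨
      B H i j                                                  ≡⟨ difference i j ⟩
      B₁ i j - B₂ i j
        ≡⟨ solve 3 (λ u v t → u :- v := con (1ℚ + 1ℚ) :* (u :- t) :+ (con (1ℚ + 1ℚ) :* t :- (u :+ v))) refl (B₁ i j) (B₂ i j) (A₃′ i j) ⟩
      (1ℚ + 1ℚ) * (B₁ i j - A₃′ i j) + ((1ℚ + 1ℚ) * A₃′ i j - (B₁ i j + B₂ i j))
        ≡⟨ cong₂ (λ u v → (1ℚ + 1ℚ) * u + ((1ℚ + 1ℚ) * A₃′ i j - v)) (C≈O i j) (B₁+B₂≡S i j) ⟩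
      (1ℚ + 1ℚ) * 0ℚ + ((1ℚ + 1ℚ) * A₃′ i j - S i j)
        ≡⟨ cong₂ (λ u v → (1ℚ + 1ℚ) * 0ℚ + ((1ℚ + 1ℚ) * u - v)) (R⊗-entry E l) (R⊗-entry (D (suc zero)) l) ⟩
      (1ℚ + 1ℚ) * 0ℚ + ((1ℚ + 1ℚ) * E (pos p₀ p₀) l - 1ℚ)
        ≡⟨ solve 1 (λ e → con (1ℚ + 1ℚ) :* con 0ℚ :+ (con (1ℚ + 1ℚ) :* e :- con 1ℚ) := con (1ℚ + 1ℚ) :* e :+ con (- 1ℚ)) refl (E (pos p₀ p₀) l) ⟩
      (1ℚ + 1ℚ) * E (pos p₀ p₀) l + - 1ℚ                       ∎)
    -- If `A₅` = B₂ were zero, then B = S, so the same row would be constantly 1: coefficient 0 for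
    -- `E` and constant 1.
    C-nonzero (suc (suc (suc (suc (suc zero))))) C≈O = 1≢0 (Bᵇ-row-affine 0≢a₁ (pos p₀ p₀) (pos p₁ p₀) 0ℚ 1ℚ E≡0 λ l →
      let i = at zero p₀ p₀ ; j = column l in begin
      Bᵇ zero a₁ (pos p₀ p₀) l                                 ≡⟨ blocks-combine Bᵇ zero a₁ (pos p₀ p₀) l ⟨
      blocks Bᵇ i j                                            ≡⟨ B≈blocks i j ⟨
      B H i j                                                  ≡⟨ difference i j ⟩
      B₁ i j - B₂ i j
        ≡⟨ solve 2 (λ u v → u :- v := (u :+ v) :- con (1ℚ + 1ℚ) :* v) refl (B₁ i j) (B₂ i j) ⟩
      (B₁ i j + B₂ i j) - (1ℚ + 1ℚ) * B₂ i j
        ≡⟨ cong₂ (λ u v → u - (1ℚ + 1ℚ) * v) (trans (B₁+B₂≡S i j) (R⊗-entry (D (suc zero)) l)) (C≈O i j) ⟩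
      1ℚ - (1ℚ + 1ℚ) * 0ℚ
        ≡⟨ solve 1 (λ e → con 1ℚ := con 0ℚ :* e :+ con 1ℚ) refl (E (pos p₀ p₀) l) ⟩
      0ℚ * E (pos p₀ p₀) l + 1ℚ                                ∎)

    isScheme : IsSymmetricAssociationScheme 5 C
    isScheme = record
      { zeroOne   = C-zeroOne
      ; nonzero   = C-nonzero
      ; symmetric = C-sym
      ; identity  = λ i j → refl
      ; partition = C-partition
      ; product   = λ i j → span⇒coefficients (C-product i j)
      }

theorem3p3 : (n m : ℕ) .{{_ : NonZero n}} → 2 ≤ m →
    (H : Vector (SqMatrix (order n)) m) →
    (∀ i → IsBushType n (H i)) →
    MutuallyUnbiased H →
    let open Construction n m in
    IsSymmetric (B H) ×
    IsZeroOneMinusOne (B H) ×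
    (∃[ B₁ ] ∃[ B₂ ] IsSplitting (B H) B₁ B₂) ×
    (∀ B₁ B₂ → IsSplitting (B H) B₁ B₂ →
    IsSymmetricAssociationScheme 5 (classes B₁ B₂))
theorem3p3 n m (s≤s _) H bush unbiased =
  -- Matching on the bound for `m` exposes a successor, so `suc zero` is a block index different
  -- from `zero`; it selects the off-diagonal block used for nonvanishing.
  B-sym , B-0±1 , (_ , _ , splitting) , λ B₁ B₂ split → isScheme B₁ B₂ split {suc zero} λ ()
  where open Scheme n m H bush unbiased
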